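{- For the J-shape 6-omino $J$ the following hold. (0) $J$ is not a rep-tile of rep-$k^2$ for any odd $k\neq 1$, nor for $k=2,4,8,10,14,16,20,22$. (1) For $k=6$: the solutions are exactly those obtained as follows. Dissect the 216-omino $6J=([0,6]\times[0,18])\cup([6,12]\times[0,6])\cup([12,18]\times[0,12])$ into 18 rectangles of size $3\times4$, namely: $[0,6]\times[6,18]$ into six rectangles of width 3 and height 4 (two columns, three rows), $[0,12]\times[0,6]$ into six rectangles of width 4 and height 3 (three columns, two rows), and $[12,18]\times[0,12]$ into six rectangles of width 3 and height 4 (two columns, three rows); then divide each rectangle into two copies of $J$ according to $J_{\mathrm{rec}}$ or its mirror image. (2) For $k=12$: all solutions are obtained by first dissecting the 864-omino $12J$ into 72 rectangles of size $3\times4$ (in either orientation), and then dividing each rectangle into two copies of $J$ according to $J_{\mathrm{rec}}$ or its mirror image. (3) For each of $k=18$ and $k=24$ there are solutions that contain both $J_{\mathrm{rec}}$ and $J_X$ (up to congruence, mirror images allowed).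
   Context: A polyomino is a simple polygon obtained by joining unit squares edge to edge; an $s$-omino is a polyomino of area $s$. Write $(x,y)$ for the unit square (cell) $[x,x+1]\times[y,y+1]$. The J-shape 6-omino is $J=\{(0,0),(0,1),(0,2),(1,0),(2,0),(2,1)\}$. A simple polygon $P$ is a rep-tile of rep-$n$ if it can be dissected into $n$ congruent polygons similar to $P$. For a polyomino $P$ and $n=k^2$ this is formulated as follows: scale $P$ by the factor $k$ to get $kP$, and tile $kP$ by $k^2$ copies of $P$ (translations, rotations and reflections allowed), each copy being a union of unit cells of the grid. Such a tiling of $kP$ is called a solution for $k$. $J_{\mathrm{rec}}$ is the $3\times4$ rectangle divided into the two copies $J$ and $\{(1,1),(1,2),(2,2),(3,0),(3,1),(3,2)\}$ of $J$. $J_X$ is the 12-omino divided into the two copies $J$ and $\{(1,1),(1,2),(1,3),(0,3),(-1,3),(-1,2)\}$. A solution contains $J_{\mathrm{rec}}$ (resp. $J_X$) if some two of its pieces form a configuration congruent (mirror images allowed) to $J_{\mathrm{rec}}$ (resp. $J_X$). -}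

module Defs where

open import Level using (0ℓ)
open import Data.Bool.Base using (Bool; if_then_else_)
open import Data.Fin.Base using (Fin; zero; suc; toℕ)
open import Data.Integer.Base using (ℤ; +_; -_; _+_; _*_; _≤_; _<_; -1ℤ)
open import Data.List.Base using (List; []; _∷_)
open import Data.List.Membership.Propositional using (_∈_)
open import Data.Nat.Base as ℕ using (ℕ)
open import Data.Product using (_×_; _,_; ∃-syntax; Σ-syntax; uncurry)
open import Data.Sum.Base using (_⊎_; [_,_])
open import Function.Bundles using (_↔_; Inverse)
open import Relation.Binary.PropositionalEquality using (_≡_; _≢_)
open import Relation.Unary using (Pred; _≐_; _⊥_; ⋃)

-- (x , y) stands for the unit square [x , x+1] × [y , y+1].
Cell : Set
Cell = ℤ × ℤ

Region : Set₁
Region = Pred Cell 0ℓ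

cells : List Cell → Region
cells cs c = c ∈ cs

-- The w × h rectangle with lower left corner (x , y).
rectangle : Cell → (w h : ℕ) → Region
rectangle (x , y) w h (a , b) =
  (x ≤ a × a < x + + w) × (y ≤ b × b < y + + h)

-- Magnification by k about the origin: each cell becomes a k × k square.
scale : ℕ → Region → Region
scale k P c = ∃[ x ] ∃[ y ] (P (x , y) × rectangle (+ k * x , + k * y) k k c)

-- A symmetry of the grid, acting on lower left corners of cells: optionally
-- exchange the coordinates, optionally negate each of them, then translate.
-- A reflection x ↦ - x of the plane takes the cell at x to the cell at - x - 1;
-- the extra - 1 is absorbed by the translation, so these are exactly the maps
-- induced on cells by the isometries of the plane that preserve the grid.
record Isometry : Set where
  field
    transpose   : Bool
    flipX flipY : Bool
    shiftX      : ℤ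
    shiftY      : ℤ

  negateIf : Bool → ℤ → ℤ
  negateIf b z = if b then - z else z

  linear : Cell → Cell
  linear (x , y) = if transpose then (y , x) else (x , y)

  act : Cell → Cell
  act c = let (x , y) = linear c in
    negateIf flipX x + shiftX , negateIf flipY y + shiftY

open Isometry public using (act)

image : Isometry → Region → Region
image g P c = ∃[ d ] (P d × act g d ≡ c)

Congruent : Region → Region → Set
Congruent P Q = ∃[ g ] (image g P ≐ Q)

Dissects : {I : Set} → Region → (I → Region) → Set
Dissects {I} R p = (R ≐ ⋃ I p) × (∀ {i j} → i ≢ j → p i ⊥ p j)

IsSolution : (P : Region) (k : ℕ) → (Fin (k ℕ.^ 2) → Region) → Set
IsSolution P k p = (∀ i → Congruent P (p i)) × Dissects (scale k P) p

-- P is a rep-tile of rep-k².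
IsRepTile-rep[_^2] : ℕ → Region → Set₁
IsRepTile-rep[ k ^2] P = ∃[ p ] IsSolution P k p

-- The numbering of the pieces of a dissection is irrelevant.
SamePieces : {I J : Set} → (I → Region) → (J → Region) → Set
SamePieces {I} {J} p q = Σ[ σ ∈ I ↔ J ] (∀ i → p i ≐ q (Inverse.to σ i))

-- A figure made of two pieces, with its division into them.
Pair : Set₁
Pair = Fin 2 → Region

Contains : {I : Set} → (I → Region) → Pair → Set
Contains p C = ∃[ g ] (∀ b → ∃[ i ] (p i ≐ image g (C b)))

J : Region
J = cells ((+ 0 , + 0) ∷ (+ 0 , + 1) ∷ (+ 0 , + 2)
         ∷ (+ 1 , + 0) ∷ (+ 2 , + 0) ∷ (+ 2 , + 1) ∷ [])

J-rec : Pair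
J-rec zero       = J
J-rec (suc zero) = cells ((+ 1 , + 1) ∷ (+ 1 , + 2) ∷ (+ 2 , + 2)
                        ∷ (+ 3 , + 0) ∷ (+ 3 , + 1) ∷ (+ 3 , + 2) ∷ [])

J-X : Pair
J-X zero       = J
J-X (suc zero) = cells ((+ 1 , + 1) ∷ (+ 1 , + 2) ∷ (+ 1 , + 3)
                      ∷ (+ 0 , + 3) ∷ (-1ℤ , + 3) ∷ (-1ℤ , + 2) ∷ [])

-- Isometries include reflections, so the mirror image of J-rec is covered.
DividedByJ-rec : {I K : Set} → (I → Region) → (K → Region) → Set
DividedByJ-rec {I} rect p =
  Σ[ g ∈ (I → Isometry) ]
    ( (∀ i → image (g i) (⋃ (Fin 2) J-rec) ≐ rect i)
    × SamePieces p (uncurry λ i b → image (g i) (J-rec b)) )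

-- p arises by dissecting kJ into the given rectangles and dividing each of
-- them into two copies of J.
ObtainedFrom : {I K : Set} (k : ℕ) → (I → Region) → (K → Region) → Set
ObtainedFrom k rect p = Dissects (scale k J) rect × DividedByJ-rec rect p

Is3×4Rectangle : Region → Set
Is3×4Rectangle R = ∃[ c ] (R ≐ rectangle c 3 4 ⊎ R ≐ rectangle c 4 3)

-- m columns and n rows of w × h rectangles, the lowest leftmost having lower
-- left corner (x , y).
gridOf : (w h : ℕ) (m n : ℕ) → Cell → Fin m × Fin n → Region
gridOf w h m n (x , y) (i , j) =
  rectangle (x + + (w ℕ.* toℕ i) , y + + (h ℕ.* toℕ j)) w h

rectanglesOf6J :
  (Fin 2 × Fin 3) ⊎ (Fin 3 × Fin 2) ⊎ (Fin 2 × Fin 3) → Region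
rectanglesOf6J =
  [ gridOf 3 4 2 3 (+ 0 , + 6)
  , [ gridOf 4 3 3 2 (+ 0 , + 0)
    , gridOf 3 4 2 3 (+ 12 , + 0) ] ]

{-# OPTIONS --safe #-}

-- The notch (1 , 1) of a piece can only be filled by an arm of another piece,
-- whose notch is filled in return: the two form J-rec or J-X, since the third
-- possibility encloses a hole of one cell.  So for k ≥ 2 the pieces are matched
-- in pairs: k² is even, and kJ is tiled by 3 × 4 rectangles and by X-shapes made
-- of two 3 × 2 blocks.  Three cells in a row meet each class of x - y modulo 3
-- once, so these tiles meet the classes equally often, but kJ does not if 3 ∤ k.
-- For k = 6 and k = 12 an exhaustive search shows which tiles can occur: kJ is
-- filled cell by cell, and partial tilings covering the same cells are merged,
-- which leaves at most a few hundred states at a time.  For k = 18 and k = 24 a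
-- 15 × 16 rectangle tiled with two X-shapes is put into kJ, and the rest is
-- cut into 3 × 4 rectangles.
module Submission where

open import Defs
open import Data.Bool.Base using (Bool; T; true; false; if_then_else_; not; _∧_; _∨_; _xor_)
import Data.Bool.Properties as Bool
open import Data.Bool.Properties using (T?; T-≡; T-∧; T-not-≡; ∨-conicalˡ; ∨-conicalʳ)
open import Data.Bool.ListAction using (any; all)
open import Data.Empty using (⊥; ⊥-elim)
open import Data.Fin.Base using (Fin; zero; suc; toℕ; fromℕ<; cast)
import Data.Fin.Base as Fin
import Data.Fin.Properties as Fin
open import Data.Fin.Permutation using (↔⇒≡)
open import Data.List.Base using (List; []; _∷_; _++_; map; concat; concatMap; cartesianProduct; filter; length; lookup; tabulate; allFin; upTo; downFrom)
open import Data.List.Properties using (map-∘; map-cong; map-++)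
open import Data.List.Membership.Propositional using (_∈_; _∉_; find)
open import Data.List.Membership.Propositional.Properties
open import Data.List.Membership.Propositional.Properties.WithK using (unique∧set⇒bag)
import Data.List.Membership.DecPropositional as DecMembership
open import Data.List.Relation.Binary.BagAndSetEquality using (∼bag⇒↭)
open import Data.List.Relation.Binary.Permutation.Propositional using (_↭_)
import Data.List.Relation.Binary.Permutation.Propositional.Properties as Perm
open import Data.List.Relation.Unary.Any as Any using (Any; here; there; any?)
open import Data.List.Relation.Unary.Any.Properties using (any⁻; lookup-index)
open import Data.List.Relation.Unary.All as All using (All; []; _∷_; all?)
import Data.List.Relation.Unary.All.Properties as All
open import Data.List.Relation.Unary.All.Properties using (all⁺; All¬⇒¬Any)
open import Data.List.Relation.Unary.AllPairs using ([]; _∷_)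
import Data.List.Relation.Unary.AllPairs.Properties as AllPairs
open import Data.List.Relation.Unary.Unique.Propositional using (Unique)
import Data.List.Relation.Unary.Unique.Propositional.Properties as Unique
open import Data.List.Relation.Unary.Unique.DecPropositional using (unique?)
open import Data.Nat.Base using (ℕ; zero; suc; _^_; NonZero; >-nonZero; z≤n; s≤s)
open import Data.Nat.DivMod
open import Data.Nat.Divisibility using (_∣_; divides; divides-refl; _∣0; m∣m*n)
open import Data.Nat.ListAction using (sum)
open import Data.Nat.ListAction.Properties using (sum-++; sum-↭)
open import Data.Nat.Primality using (euclidsLemma; prime[2])
open import Data.Product using (_×_; _,_; proj₁; proj₂; ∃-syntax; Σ-syntax; uncurry)
import Data.Product.Properties as Product
open import Data.Sum.Base using (_⊎_; inj₁; inj₂; [_,_]′)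
import Data.Sum.Properties as Sum
open import Function.Base using (_∘_; id)
open import Function.Bundles using (_⇔_; _↔_; Equivalence; Inverse; mk⇔; mk↔ₛ′)
open import Function.Construct.Composition using (_↔-∘_)
open import Function.Construct.Symmetry using (↔-sym)
open import Relation.Binary.Definitions using (DecidableEquality; tri<; tri≈; tri>)
open import Relation.Binary.PropositionalEquality hiding (J)
open import Relation.Nullary using (Dec; yes; no; does; contradiction)
open import Relation.Nullary.Decidable using (_×-dec_; _⊎-dec_; _→-dec_; from-yes; isYes; toWitness)
open import Relation.Nullary.Negation using (¬_)
open import Relation.Unary using (_≐_; ⋃)
open import Relation.Unary.Properties using (≐-refl; ≐-sym; ≐-trans)

-- Both searches are evaluated by the type checker, which dictates the encoding: a set of cells is
-- one natural number, so that testing, placing and comparing are arithmetic. Soundness does not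
-- describe the set of all states. It follows one given tiling and shows that after every cell of
-- the sweep some state records exactly the tiles of it met so far. Merging is therefore harmless as
-- long as a state keeps one bit of history: whether a bad tile may have been used.
--
-- The bound `k ≥ 2` acts through a single property, `Gapless`: a cell between two cells of kJ lies
-- in kJ. It brings the notch of every piece, and the enclosed hole of the third possibility, into
-- kJ, so that some piece has to fill them. J itself violates it at its own notch.
--
-- Symmetries need negative coordinates, masks and colour counts need natural ones. The bridge is
-- that a matched pair has one of six outlines, whose lower left corner is natural because the pair
-- lies in kJ.

module Counting where

  open import Data.List.Relation.Unary.All.Properties using (map⁺)
  open import Data.Nat.Base
  open import Data.Nat.Properties
  open import Data.Nat.Tactic.RingSolver using (solve-∀)
  open import Data.Product.Properties using (≡-dec)

  -- Binary digits of natural numbers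

  -- The default 0 for the divisor 0 lets powers of two serve as divisors without evidence that they
  -- are nonzero.
  quot : ℕ → ℕ → ℕ
  quot m zero    = 0
  quot m (suc d) = m / suc d

  odd : ℕ → Bool
  odd n = n % 2 ≡ᵇ 1

  bit : ℕ → ℕ → Bool
  bit m i = odd (quot m (2 ^ i))

  -- This allows the search to divide once by the power of the current cell and then to test all
  -- placements relative to that cell.
  quot-* : ∀ m a b → quot m (a * b) ≡ quot (quot m a) b
  quot-* m zero    zero    = refl
  quot-* m zero    (suc b) = sym (0/n≡0 (suc b))
  quot-* m (suc a) zero    = cong (quot m) (*-zeroʳ a)
  quot-* m (suc a) (suc b) = sym (m/n/o≡m/[n*o] m (suc a) (suc b))

  bit-suc : ∀ m i → bit m (suc i) ≡ bit (m / 2) i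
  bit-suc m i = cong odd (quot-* m 2 (2 ^ i))

  even-decomp : ∀ m → odd m ≡ false → m ≡ m / 2 * 2
  even-decomp m eq with m % 2 | m%n<n m 2 | m≡m%n+[m/n]*n m 2
  even-decomp m _  | 0 | _ | e = e
  even-decomp m () | 1 | _ | _
  even-decomp m _  | suc (suc _) | s≤s (s≤s ()) | _

  suc-half : ∀ m → odd m ≡ false → (m + 1) / 2 ≡ m / 2
  suc-half m eq = begin
    (m + 1) / 2         ≡⟨ cong (λ n → (n + 1) / 2) (even-decomp m eq) ⟩
    (m / 2 * 2 + 1) / 2 ≡⟨ cong (_/ 2) (+-comm (m / 2 * 2) 1) ⟩
    (1 + m / 2 * 2) / 2 ≡⟨ +-distrib-/-∣ʳ 1 {d = 2} (divides-refl (m / 2)) ⟩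
    m / 2 * 2 / 2       ≡⟨ m*n/n≡m (m / 2) 2 ⟩
    m / 2               ∎
    where open ≡-Reasoning

  suc-odd : ∀ m → odd m ≡ false → odd (m + 1) ≡ true
  suc-odd m eq = cong (_≡ᵇ 1) (begin
    (m + 1) % 2         ≡⟨ cong (λ n → (n + 1) % 2) (even-decomp m eq) ⟩
    (m / 2 * 2 + 1) % 2 ≡⟨ cong (_% 2) (+-comm (m / 2 * 2) 1) ⟩
    (1 + m / 2 * 2) % 2 ≡⟨ [m+kn]%n≡m%n 1 (m / 2) 2 ⟩
    1                   ∎)
    where open ≡-Reasoning

  -- Digit `i` of `m` is 0, so the addition carries nothing. The induction halves `m` and lowers
  -- both indices.
  bit-set : ∀ m i j → bit m i ≡ false → bit (m + 2 ^ i) j ≡ (i ≡ᵇ j) ∨ bit m j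
  bit-set m zero zero eq =
    trans (cong odd (n/1≡n (m + 1))) (suc-odd m (trans (cong odd (sym (n/1≡n m))) eq))
  bit-set m zero (suc j) eq = begin
    bit (m + 1) (suc j)   ≡⟨ bit-suc (m + 1) j ⟩
    bit ((m + 1) / 2) j   ≡⟨ cong (λ n → bit n j) (suc-half m (trans (cong odd (sym (n/1≡n m))) eq)) ⟩
    bit (m / 2) j         ≡⟨ bit-suc m j ⟨
    bit m (suc j)         ∎
    where open ≡-Reasoning
  bit-set m (suc i) zero eq = cong (_≡ᵇ 1) (begin
    (m + 2 * 2 ^ i) / 1 % 2 ≡⟨ cong (_% 2) (n/1≡n (m + 2 * 2 ^ i)) ⟩
    (m + 2 * 2 ^ i) % 2     ≡⟨ cong (λ n → (m + n) % 2) (*-comm 2 (2 ^ i)) ⟩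
    (m + 2 ^ i * 2) % 2     ≡⟨ [m+kn]%n≡m%n m (2 ^ i) 2 ⟩
    m % 2                   ≡⟨ cong (_% 2) (n/1≡n m) ⟨
    m / 1 % 2               ∎)
    where open ≡-Reasoning
  bit-set m (suc i) (suc j) eq = begin
    bit (m + 2 * 2 ^ i) (suc j)       ≡⟨ bit-suc (m + 2 * 2 ^ i) j ⟩
    bit ((m + 2 * 2 ^ i) / 2) j       ≡⟨ cong (λ n → bit ((m + n) / 2) j) (*-comm 2 (2 ^ i)) ⟩
    bit ((m + 2 ^ i * 2) / 2) j       ≡⟨ cong (λ n → bit n j) (+-distrib-/-∣ʳ m {d = 2} (divides-refl (2 ^ i))) ⟩
    bit (m / 2 + 2 ^ i * 2 / 2) j     ≡⟨ cong (λ n → bit (m / 2 + n) j) (m*n/n≡m (2 ^ i) 2) ⟩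
    bit (m / 2 + 2 ^ i) j             ≡⟨ bit-set (m / 2) i j (trans (sym (bit-suc m i)) eq) ⟩
    (i ≡ᵇ j) ∨ bit (m / 2) j          ≡⟨ cong ((i ≡ᵇ j) ∨_) (bit-suc m j) ⟨
    (i ≡ᵇ j) ∨ bit m (suc j)          ∎
    where open ≡-Reasoning

  bit-set-same : ∀ m i → bit m i ≡ false → bit (m + 2 ^ i) i ≡ true
  bit-set-same m i eq rewrite bit-set m i i eq with i ≡ᵇ i | ≡⇒≡ᵇ i i refl
  ... | true | _ = refl

  bit-set-other : ∀ m i j → bit m i ≡ false → i ≢ j → bit (m + 2 ^ i) j ≡ bit m j
  bit-set-other m i j eq i≢j rewrite bit-set m i j eq with i ≡ᵇ j in e
  ... | false = refl
  ... | true  = ⊥-elim (i≢j (≡ᵇ⇒≡ i j (subst T (sym e) _)))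

  -- Sets of cells as natural numbers

  Cellℕ : Set
  Cellℕ = ℕ × ℕ

  infixl 6 _⊹_
  _⊹_ : Cellℕ → Cellℕ → Cellℕ
  (x , y) ⊹ (a , b) = (x + a , y + b)

  ⊹-assoc : ∀ a b c → a ⊹ b ⊹ c ≡ a ⊹ (b ⊹ c)
  ⊹-assoc (a , a′) (b , b′) (c , c′) = cong₂ _,_ (+-assoc a b c) (+-assoc a′ b′ c′)

  ⊹-comm : ∀ a b → a ⊹ b ≡ b ⊹ a
  ⊹-comm (a , a′) (b , b′) = cong₂ _,_ (+-comm a b) (+-comm a′ b′)

  ⊹-cancelˡ : ∀ a {b c} → a ⊹ b ≡ a ⊹ c → b ≡ c
  ⊹-cancelˡ (a , a′) eq =
    cong₂ _,_ (+-cancelˡ-≡ a _ _ (cong proj₁ eq)) (+-cancelˡ-≡ a′ _ _ (cong proj₂ eq))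

  ⊹-cancelʳ : ∀ a {b c} → b ⊹ a ≡ c ⊹ a → b ≡ c
  ⊹-cancelʳ a {b} {c} eq = ⊹-cancelˡ a (trans (⊹-comm a b) (trans eq (⊹-comm c a)))

  -- A set of cells (x , y) with x < W is the natural number whose binary digit
  -- number x + W y tells whether the cell belongs to the set.
  module Mask (W : ℕ) where

    pow : Cellℕ → ℕ
    pow (x , y) = 2 ^ x * (2 ^ W) ^ y

    has : ℕ → Cellℕ → Bool
    has m c = odd (quot m (pow c))

    fill : ℕ → List Cellℕ → ℕ
    fill m cs = m + sum (map pow cs)

    pos : Cellℕ → ℕ
    pos (x , y) = x + W * y

    pow≡2^pos : ∀ c → pow c ≡ 2 ^ pos c
    pow≡2^pos (x , y) =
      trans (cong (2 ^ x *_) (^-*-assoc 2 W y)) (sym (^-distribˡ-+-* 2 x (W * y)))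

    pos-⊹ : ∀ c d → pos (c ⊹ d) ≡ pos c + pos d
    pos-⊹ (x , y) (a , b) = lemma x y a b W
      where
      lemma : ∀ x y a b W → x + a + W * (y + b) ≡ x + W * y + (a + W * b)
      lemma = solve-∀

    -- Translating a set of cells multiplies its number by a power of two, which is why a candidate
    -- can be stored once and used at every cell.
    pow-⊹ : ∀ c d → pow (c ⊹ d) ≡ pow c * pow d
    pow-⊹ c d rewrite pow≡2^pos (c ⊹ d) | pow≡2^pos c | pow≡2^pos d | pos-⊹ c d =
      ^-distribˡ-+-* 2 (pos c) (pos d)

    has≡bit : ∀ m c → has m c ≡ bit m (pos c)
    has≡bit m c = cong (odd ∘ quot m) (pow≡2^pos c)

    -- In the strip the first coordinate is the remainder modulo `W`. Beyond it a row would run into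
    -- the next one, hence the conditions `InStrip` below.
    pos-injective : ∀ {c d} → proj₁ c < W → proj₁ d < W → pos c ≡ pos d → c ≡ d
    pos-injective {x , y} {a , b} x<W a<W eq = cong₂ _,_ x≡a y≡b
      where
      instance
        _ : NonZero W
        _ = >-nonZero (≤-<-trans z≤n x<W)
      mod : ∀ u v → u < W → (u + W * v) % W ≡ u
      mod u v u<W = trans (cong (λ n → (u + n) % W) (*-comm W v))
        (trans ([m+kn]%n≡m%n u v W) (m<n⇒m%n≡m u<W))
      x≡a : x ≡ a
      x≡a = trans (sym (mod x y x<W)) (trans (cong (_% W) eq) (mod a b a<W))
      y≡b : y ≡ b
      y≡b = *-cancelˡ-≡ y b W (+-cancelˡ-≡ x _ _ (trans eq (cong (_+ W * b) (sym x≡a))))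

    has-set-same : ∀ m c → has m c ≡ false → has (m + pow c) c ≡ true
    has-set-same m c eq rewrite has≡bit (m + pow c) c | has≡bit m c | pow≡2^pos c =
      bit-set-same m (pos c) eq

    has-set-other : ∀ m c d → has m c ≡ false → proj₁ c < W → proj₁ d < W → c ≢ d →
                    has (m + pow c) d ≡ has m d
    has-set-other m c d eq c<W d<W c≢d
      rewrite has≡bit (m + pow c) d | has≡bit m c | has≡bit m d | pow≡2^pos c =
      bit-set-other m (pos c) (pos d) eq (c≢d ∘ pos-injective c<W d<W)

    Free : ℕ → List Cellℕ → Set
    Free m = All (λ c → has m c ≡ false)

    InStrip : List Cellℕ → Set
    InStrip = All (λ c → proj₁ c < W)

    private
      free-tail : ∀ {m c cs} → All (c ≢_) cs → Free m (c ∷ cs) → InStrip (c ∷ cs) → Free (m + pow c) cs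
      free-tail {m} {c} c∉ (f ∷ fs) (i ∷ is) = go c∉ fs is
        where
        go : ∀ {cs} → All (c ≢_) cs → Free m cs → InStrip cs → Free (m + pow c) cs
        go [] [] [] = []
        go (ne ∷ nes) (g ∷ gs) (j ∷ js) =
          trans (has-set-other m c _ f i j ne) g ∷ go nes gs js

    fill-∷ : ∀ m c cs → fill m (c ∷ cs) ≡ fill (m + pow c) cs
    fill-∷ m c cs = sym (+-assoc m (pow c) _)

    has-fill-∉ : ∀ {m cs d} → Unique cs → Free m cs → InStrip cs → proj₁ d < W → d ∉ cs →
                 has (fill m cs) d ≡ has m d
    has-fill-∉ {m} {[]} {d} _ _ _ _ _ = cong (λ n → has n d) (+-identityʳ m)
    has-fill-∉ {m} {c ∷ cs} {d} (c∉ ∷ u) free@(f ∷ _) strip@(i ∷ is) d<W d∉ = begin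
      has (fill m (c ∷ cs)) d      ≡⟨ cong (λ n → has n d) (fill-∷ m c cs) ⟩
      has (fill (m + pow c) cs) d  ≡⟨ has-fill-∉ u (free-tail c∉ free strip) is d<W (d∉ ∘ there) ⟩
      has (m + pow c) d            ≡⟨ has-set-other m c d f i d<W (λ e → d∉ (here (sym e))) ⟩
      has m d                      ∎
      where open ≡-Reasoning

    has-fill-∈ : ∀ {m cs d} → Unique cs → Free m cs → InStrip cs → d ∈ cs →
                 has (fill m cs) d ≡ true
    has-fill-∈ {m} {c ∷ cs} {d} (c∉ ∷ u) free@(f ∷ _) strip@(i ∷ is) (here refl) =
      trans (cong (λ n → has n d) (fill-∷ m c cs))
        (trans (has-fill-∉ u (free-tail c∉ free strip) is i (All¬⇒¬Any c∉))
          (has-set-same m c f))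
    has-fill-∈ {m} {c ∷ cs} {d} (c∉ ∷ u) free strip@(i ∷ is) (there d∈) =
      trans (cong (λ n → has n d) (fill-∷ m c cs))
        (has-fill-∈ u (free-tail c∉ free strip) is d∈)

  *-distribˡ-sum : ∀ m ns → m * sum ns ≡ sum (map (m *_) ns)
  *-distribˡ-sum m []       = *-zeroʳ m
  *-distribˡ-sum m (n ∷ ns) =
    trans (*-distribˡ-+ m n (sum ns)) (cong (m * n +_) (*-distribˡ-sum m ns))

  -- Outlines of pairs, and tilings by them

  -- The images of the outlines of `J-rec` and `J-X` under the eight symmetries. The X-shape is
  -- invariant under the half turn, which leaves four images.
  data Shape : Set where
    V H X₁ X₂ X₃ X₄ : Shape

  shapes : List Shape
  shapes = V ∷ H ∷ X₁ ∷ X₂ ∷ X₃ ∷ X₄ ∷ []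

  box : ℕ → ℕ → List Cellℕ
  box w h = cartesianProduct (upTo w) (upTo h)

  cellsOf : Shape → List Cellℕ
  cellsOf V  = box 3 4
  cellsOf H  = box 4 3
  cellsOf X₁ = map ((1 , 0) ⊹_) (box 3 2) ++ map ((0 , 2) ⊹_) (box 3 2)
  cellsOf X₂ = map ((0 , 0) ⊹_) (box 3 2) ++ map ((1 , 2) ⊹_) (box 3 2)
  cellsOf X₃ = map ((0 , 1) ⊹_) (box 2 3) ++ map ((2 , 0) ⊹_) (box 2 3)
  cellsOf X₄ = map ((0 , 0) ⊹_) (box 2 3) ++ map ((2 , 1) ⊹_) (box 2 3)

  ∈-shapes : ∀ s → s ∈ shapes
  ∈-shapes V  = here refl
  ∈-shapes H  = there (here refl)
  ∈-shapes X₁ = there (there (here refl))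
  ∈-shapes X₂ = there (there (there (here refl)))
  ∈-shapes X₃ = there (there (there (there (here refl))))
  ∈-shapes X₄ = there (there (there (there (there (here refl)))))

  cellsOf-unique : ∀ s → Unique (cellsOf s)
  cellsOf-unique s = All.lookup (from-yes (All.all? (λ s → unique? (≡-dec _≟_ _≟_) (cellsOf s)) shapes)) (∈-shapes s)

  cellsOf-≤3 : ∀ s {d} → d ∈ cellsOf s → proj₁ d ≤ 3 × proj₂ d ≤ 3
  cellsOf-≤3 s d∈ = All.lookup (All.lookup small (∈-shapes s)) d∈
    where
    small : All (λ s → All (λ d → proj₁ d ≤ 3 × proj₂ d ≤ 3) (cellsOf s)) shapes
    small = from-yes (All.all? (λ s → All.all? (λ d → (proj₁ d ≤? 3) ×-dec (proj₂ d ≤? 3)) (cellsOf s)) shapes)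

  place : Shape → Cellℕ → List Cellℕ
  place s o = map (o ⊹_) (cellsOf s)

  place-unique : ∀ s o → Unique (place s o)
  place-unique s o = Unique.map⁺ (⊹-cancelˡ o) (cellsOf-unique s)

  place-nonempty : ∀ s o → ∃[ c ] c ∈ place s o
  place-nonempty V  o = _ , here refl
  place-nonempty H  o = _ , here refl
  place-nonempty X₁ o = _ , here refl
  place-nonempty X₂ o = _ , here refl
  place-nonempty X₃ o = _ , here refl
  place-nonempty X₄ o = _ , here refl

  record Tiling (R : List Cellℕ) : Set where
    field
      size   : ℕ
      shape  : Fin size → Shape
      anchor : Fin size → Cellℕ

    tile : Fin size → List Cellℕ
    tile a = place (shape a) (anchor a)

    field
      covers : ∀ {c} → c ∈ R → ∃[ a ] c ∈ tile a
      inside : ∀ a {c} → c ∈ tile a → c ∈ R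
      apart  : ∀ {a b c} → c ∈ tile a → c ∈ tile b → a ≡ b

  -- Cells are shifted by the margin, so that every placement of a shape on a
  -- cell of the region stays in the quadrant where masks make sense.
  margin : Cellℕ
  margin = (3 , 3)

  -- Exhaustive search and its soundness

  module Search (W : ℕ) (bad : Shape → Cellℕ → Bool) where
    open Mask W

    -- The set of the covered cells, and whether a bad tile may have been used.
    State : Set
    State = ℕ × Bool

    -- A placement relative to the cell to be covered; the powers of two of its
    -- cells are stored so that they are computed only once.
    record Candidate : Set where
      constructor candidate
      field
        shape  : Shape
        offset : Cellℕ
        powers : List ℕ
        total  : ℕ

    open Candidate

    -- `(a , b)` is the cell of the shape that is to lie on the cell being covered. It has
    -- coordinates at most 3, the margin, so the subtractions are exact.
    mkCandidate : Shape → Cellℕ → Candidate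
    mkCandidate s (a , b) = candidate s o ps (sum ps)
      where
      o  = (3 ∸ a , 3 ∸ b)
      ps = map (pow ∘ (o ⊹_)) (cellsOf s)

    candidates : List Candidate
    candidates = concatMap (λ s → map (mkCandidate s) (cellsOf s)) shapes

    fits : ℕ → List ℕ → Bool
    fits q []       = true
    fits q (p ∷ ps) = if odd (quot q p) then false else fits q ps

    -- The flags are compared too, so a clean state is never absorbed by a flagged one or the other
    -- way round.
    _==_ : State → State → Bool
    (m , true)  == (n , true)  = m ≡ᵇ n
    (m , false) == (n , false) = m ≡ᵇ n
    (m , _)     == (n , _)     = false

    insert : State → List State → List State
    insert s ss = if any (s ==_) ss then ss else s ∷ ss

    expand : Cellℕ → ℕ → State → ℕ → List Candidate → List State → List State
    expand c p (m , f) q []       acc = acc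
    expand c p (m , f) q (k ∷ ks) acc =
      if fits q (powers k)
      then insert (m + p * total k , f ∨ bad (shape k) (c ⊹ offset k)) (expand c p (m , f) q ks acc)
      else expand c p (m , f) q ks acc

    step : List Candidate → Cellℕ → ℕ → List State → List State
    step ks c p []             = []
    step ks c p ((m , f) ∷ ss) =
      -- `p` belongs to the unshifted cell, while the digits of `m` stand for shifted cells; in the
      -- placements the margin is part of the offset.
      if odd (quot m (p * pow margin))
      then insert (m , f) (step ks c p ss)
      else expand c p (m , f) (quot m p) ks (step ks c p ss)

    run : List Candidate → List Cellℕ → List State → List State
    run ks []       ss = ss
    run ks (c ∷ cs) ss = run ks cs (step ks c (pow c) ss)

    -- Asking for all of `R` to be covered also certifies that the sweep has visited enough cells.
    good : List Cellℕ → State → Bool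
    good R (m , f) = not f ∧ all (λ c → has m (c ⊹ margin)) R

    ==-sound : ∀ s t → T (s == t) → s ≡ t
    ==-sound (m , true)  (n , true)  eq = cong (_, true) (≡ᵇ⇒≡ m n eq)
    ==-sound (m , false) (n , false) eq = cong (_, false) (≡ᵇ⇒≡ m n eq)
    ==-sound (m , true)  (n , false) ()
    ==-sound (m , false) (n , true)  ()

    insert-here : ∀ s ss → s ∈ insert s ss
    insert-here s ss with any (s ==_) ss in eq
    ... | false = here refl
    ... | true  = Any.map (==-sound s _)
                    (any⁻ (s ==_) ss (subst T (sym eq) _))

    insert-there : ∀ s {ss t} → t ∈ ss → t ∈ insert s ss
    insert-there s {ss} t∈ with any (s ==_) ss
    ... | false = there t∈
    ... | true  = t∈

    expand-acc : ∀ c p s q ks {acc t} → t ∈ acc → t ∈ expand c p s q ks acc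
    expand-acc c p s q []       t∈ = t∈
    expand-acc c p s q (k ∷ ks) t∈ with fits q (powers k)
    ... | true  = insert-there _ (expand-acc c p s q ks t∈)
    ... | false = expand-acc c p s q ks t∈

    expand-here : ∀ c p m f q {ks k acc} → k ∈ ks → fits q (powers k) ≡ true →
      (m + p * total k , f ∨ bad (shape k) (c ⊹ offset k)) ∈ expand c p (m , f) q ks acc
    expand-here c p m f q {ks = k ∷ ks} (here refl) eq rewrite eq =
      insert-here _ (expand c p (m , f) q ks _)
    expand-here c p m f q {ks = k′ ∷ ks} (there k∈) eq with fits q (powers k′)
    ... | true  = insert-there _ (expand-here c p m f q k∈ eq)
    ... | false = expand-here c p m f q k∈ eq

    step-covered : ∀ ks c p {m f ss} → (m , f) ∈ ss → odd (quot m (p * pow margin)) ≡ true →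
      (m , f) ∈ step ks c p ss
    step-covered ks c p {ss = (m , f) ∷ ss} (here refl) eq rewrite eq = insert-here _ (step ks c p ss)
    step-covered ks c p {ss = (m′ , f′) ∷ ss} (there s∈) eq with odd (quot m′ (p * pow margin))
    ... | true  = insert-there _ (step-covered ks c p s∈ eq)
    ... | false = expand-acc c p (m′ , f′) (quot m′ p) ks (step-covered ks c p s∈ eq)

    step-uncovered : ∀ ks c p {m f ss k} → (m , f) ∈ ss → odd (quot m (p * pow margin)) ≡ false →
      k ∈ ks → fits (quot m p) (powers k) ≡ true →
      (m + p * total k , f ∨ bad (shape k) (c ⊹ offset k)) ∈ step ks c p ss
    step-uncovered ks c p {ss = (m , f) ∷ ss} (here refl) eq k∈ fit rewrite eq =
      expand-here c p m f (quot m p) k∈ fit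
    step-uncovered ks c p {ss = (m′ , f′) ∷ ss} (there s∈) eq k∈ fit with odd (quot m′ (p * pow margin))
    ... | true  = insert-there _ (step-uncovered ks c p s∈ eq k∈ fit)
    ... | false = expand-acc c p (m′ , f′) (quot m′ p) ks (step-uncovered ks c p s∈ eq k∈ fit)

    mkCandidate-∈ : ∀ s {d} → d ∈ cellsOf s → mkCandidate s d ∈ candidates
    mkCandidate-∈ s d∈ = ∈-concatMap⁺ (λ s → map (mkCandidate s) (cellsOf s))
      (Any.map (λ { refl → ∈-map⁺ (mkCandidate s) d∈ }) (∈-shapes s))

    fits-free : ∀ q ps → All (λ p → odd (quot q p) ≡ false) ps → fits q ps ≡ true
    fits-free q []       []           = refl
    fits-free q (p ∷ ps) (eq ∷ eqs) rewrite eq = fits-free q ps eqs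

    module Soundness {R : List Cellℕ} (t : Tiling R)
                     (narrow : ∀ {c} → c ∈ R → proj₁ (c ⊹ margin) < W) where
      open Tiling t renaming (shape to shapeOf)

      -- A state of the search that agrees with the tiling t: the covered cells
      -- form the union of the tiles a with done a.
      Agrees : State → Set
      Agrees (m , f) = Σ[ done ∈ (Fin size → Bool) ]
        (∀ a {c} → c ∈ tile a → has m (c ⊹ margin) ≡ done a) ×
        (f ≡ false → ∀ a → done a ≡ true → bad (shapeOf a) (anchor a ⊹ margin) ≡ false)

      shifted : Fin size → List Cellℕ
      shifted a = map (_⊹ margin) (tile a)

      shifted-unique : ∀ a → Unique (shifted a)
      shifted-unique a = Unique.map⁺ (⊹-cancelʳ margin) (place-unique (shapeOf a) (anchor a))

      module _ (a : Fin size) (d : Cellℕ) (d∈ : d ∈ cellsOf (shapeOf a)) where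
        private
          c = anchor a ⊹ d
          k = mkCandidate (shapeOf a) d

        offset-anchor : c ⊹ offset k ≡ anchor a ⊹ margin
        offset-anchor = trans (⊹-assoc (anchor a) d (offset k)) (cong (anchor a ⊹_)
          (cong₂ _,_ (m+[n∸m]≡n (proj₁ (cellsOf-≤3 (shapeOf a) d∈)))
                     (m+[n∸m]≡n (proj₂ (cellsOf-≤3 (shapeOf a) d∈)))))

        pow-offset : ∀ e → pow c * pow (offset k ⊹ e) ≡ pow (anchor a ⊹ e ⊹ margin)
        pow-offset e = begin
          pow c * pow (offset k ⊹ e)   ≡⟨ pow-⊹ c (offset k ⊹ e) ⟨
          pow (c ⊹ (offset k ⊹ e))     ≡⟨ cong pow (⊹-assoc c (offset k) e) ⟨
          pow (c ⊹ offset k ⊹ e)       ≡⟨ cong (λ o → pow (o ⊹ e)) offset-anchor ⟩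
          pow (anchor a ⊹ margin ⊹ e)  ≡⟨ cong pow (⊹-assoc (anchor a) margin e) ⟩
          pow (anchor a ⊹ (margin ⊹ e)) ≡⟨ cong (λ o → pow (anchor a ⊹ o)) (⊹-comm margin e) ⟩
          pow (anchor a ⊹ (e ⊹ margin)) ≡⟨ cong pow (⊹-assoc (anchor a) e margin) ⟨
          pow (anchor a ⊹ e ⊹ margin)  ∎
          where open ≡-Reasoning

        fill-candidate : ∀ m → m + pow c * total k ≡ fill m (shifted a)
        fill-candidate m = cong (m +_) (begin
          pow c * sum (map (pow ∘ (offset k ⊹_)) L)
            ≡⟨ *-distribˡ-sum (pow c) (map (pow ∘ (offset k ⊹_)) L) ⟩
          sum (map (pow c *_) (map (pow ∘ (offset k ⊹_)) L))
            ≡⟨ cong sum (map-∘ L) ⟨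
          sum (map (λ e → pow c * pow (offset k ⊹ e)) L)
            ≡⟨ cong sum (map-cong pow-offset L) ⟩
          sum (map (λ e → pow (anchor a ⊹ e ⊹ margin)) L)
            ≡⟨ cong sum (trans (map-∘ L) (map-∘ (tile a))) ⟩
          sum (map pow (shifted a)) ∎)
          where
          open ≡-Reasoning
          L = cellsOf (shapeOf a)

        fits-candidate : ∀ m → Free m (shifted a) → fits (quot m (pow c)) (powers k) ≡ true
        fits-candidate m free = fits-free _ _ (map⁺ (All.tabulate λ {e} e∈ → begin
          odd (quot (quot m (pow c)) (pow (offset k ⊹ e))) ≡⟨ cong odd (quot-* m (pow c) _) ⟨
          odd (quot m (pow c * pow (offset k ⊹ e)))        ≡⟨ cong (odd ∘ quot m) (pow-offset e) ⟩
          has m (anchor a ⊹ e ⊹ margin)  ≡⟨ All.lookup free (∈-map⁺ (_⊹ margin) (∈-map⁺ (anchor a ⊹_) e∈)) ⟩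
          false ∎))
          where open ≡-Reasoning

      strip : ∀ a → InStrip (shifted a)
      strip a = map⁺ (All.tabulate (narrow ∘ inside a))

      Complete : List Candidate → Set
      Complete ks = ∀ s {d} → d ∈ cellsOf s → mkCandidate s d ∈ ks

      -- Let `a` be the tile of `t` on `c`. If it is done, the state survives as it is. Otherwise
      -- all its cells are free, since `agree` gives one value for the whole tile, so the candidate
      -- that lays `a` on `c` fits, and placing it preserves agreement.
      step-agrees : ∀ {ks} → Complete ks → ∀ c {s ss} → c ∈ R → s ∈ ss → Agrees s →
        ∃[ s′ ] s′ ∈ step ks c (pow c) ss × Agrees s′
      step-agrees {ks} complete c {m , f} {ss} c∈ s∈ agrees@(done , agree , ok)
        with a , c∈a ← covers c∈
        with d , d∈ , refl ← ∈-map⁻ (anchor a ⊹_) c∈a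
        with done a in eq
      ... | true  = (m , f) , step-covered ks c (pow c) s∈
                      (trans (cong (odd ∘ quot m) (sym (pow-⊹ c margin))) (trans (agree a c∈a) eq)) , agrees
      ... | false = s′ ,
            step-uncovered ks c (pow c) s∈
              (trans (cong (odd ∘ quot m) (sym (pow-⊹ c margin))) (trans (agree a c∈a) eq))
              (complete (shapeOf a) d∈) (fits-candidate a d d∈ m free) ,
            done′ , agree′ , ok′
        where
        k = mkCandidate (shapeOf a) d
        s′ : State
        s′ = (m + pow c * total k , f ∨ bad (shapeOf a) (c ⊹ offset k))
        free : Free m (shifted a)
        free = map⁺ (All.tabulate λ e∈ → trans (agree a e∈) eq)
        done′ : Fin size → Bool
        done′ b = does (a Fin.≟ b) ∨ done b
        agree′ : ∀ b {e} → e ∈ tile b → has (m + pow c * total k) (e ⊹ margin) ≡ done′ b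
        agree′ b {e} e∈ rewrite fill-candidate a d d∈ m with a Fin.≟ b
        ... | yes refl = has-fill-∈ (shifted-unique a) free (strip a) (∈-map⁺ (_⊹ margin) e∈)
        ... | no a≢b = trans
          (has-fill-∉ (shifted-unique a) free (strip a) (narrow (inside b e∈)) e∉) (agree b e∈)
          where
          e∉ : e ⊹ margin ∉ shifted a
          e∉ e∈′ with e′ , e′∈ , q ← ∈-map⁻ (_⊹ margin) e∈′ =
            a≢b (apart e′∈ (subst (_∈ tile b) (⊹-cancelʳ margin q) e∈))
        ok′ : f ∨ bad (shapeOf a) (c ⊹ offset k) ≡ false → ∀ b → done′ b ≡ true →
              bad (shapeOf b) (anchor b ⊹ margin) ≡ false
        ok′ q b db with a Fin.≟ b
        ... | yes refl = trans (cong (bad (shapeOf a)) (sym (offset-anchor a d d∈))) (∨-conicalʳ f _ q)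
        ... | no _     = ok (∨-conicalˡ f _ q) b db

      run-agrees : ∀ {ks} → Complete ks → ∀ cs {s ss} → All (_∈ R) cs → s ∈ ss → Agrees s →
        ∃[ s′ ] s′ ∈ run ks cs ss × Agrees s′
      run-agrees complete []       _          s∈ agrees = _ , s∈ , agrees
      run-agrees complete (c ∷ cs) (c∈ ∷ cs∈) s∈ agrees
        with _ , s′∈ , agrees′ ← step-agrees complete c c∈ s∈ agrees =
        run-agrees complete cs cs∈ s′∈ agrees′

      -- Initially no tile is done: the cells already in `m` lie outside `R`, hence on no tile. In
      -- the final state every tile has a covered cell, so it is done, and the clear flag says that
      -- it is not bad.
      sound : ∀ {ks} → Complete ks → ∀ order m → All (_∈ R) order →
        (∀ {c} → c ∈ R → has m (c ⊹ margin) ≡ false) →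
        all (good R) (run ks order ((m , false) ∷ [])) ≡ true →
        ∀ a → bad (shapeOf a) (anchor a ⊹ margin) ≡ false
      sound complete order m order∈ free checked a
        with (m′ , f′) , s∈ , done , agree , ok ←
          run-agrees complete order order∈ (here {x = (m , false)} refl)
            ((λ _ → false) , (λ b e∈ → free (inside b e∈)) , λ _ _ ())
        = final f′ (All.lookup (all⁺ (good R) _ (subst T (sym checked) _)) s∈) ok
        where
        final : ∀ f → T (good R (m′ , f)) →
          (f ≡ false → ∀ a → done a ≡ true → bad (shapeOf a) (anchor a ⊹ margin) ≡ false) →
          bad (shapeOf a) (anchor a ⊹ margin) ≡ false
        final false covered ok with e , e∈ ← place-nonempty (shapeOf a) (anchor a) =
          ok refl a (trans (sym (agree a e∈))
            (Equivalence.to T-≡ (All.lookup (all⁺ (λ c → has m′ (c ⊹ margin)) R covered)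
              (inside a e∈))))

  -- The region kJ in natural coordinates

  isJ : Cellℕ → Bool
  isJ (0 , 0) = true
  isJ (0 , 1) = true
  isJ (0 , 2) = true
  isJ (1 , 0) = true
  isJ (2 , 0) = true
  isJ (2 , 1) = true
  isJ _       = false

  inkJ : ℕ → Cellℕ → Bool
  inkJ k (x , y) = isJ (quot x k , quot y k)

  region : ℕ → List Cellℕ
  region k = filter (T? ∘ inkJ k) (box (3 * k) (3 * k))

  region-unique : ∀ k → Unique (region k)
  region-unique k = Unique.filter⁺ (T? ∘ inkJ k) (Unique.cartesianProduct⁺ (Unique.upTo⁺ (3 * k)) (Unique.upTo⁺ (3 * k)))

  isJ-<3 : ∀ x y → T (isJ (x , y)) → x < 3 × y < 3
  isJ-<3 0 0 _ = s≤s z≤n , s≤s z≤n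
  isJ-<3 0 1 _ = s≤s z≤n , s≤s (s≤s z≤n)
  isJ-<3 0 2 _ = s≤s z≤n , s≤s (s≤s (s≤s z≤n))
  isJ-<3 1 0 _ = s≤s (s≤s z≤n) , s≤s z≤n
  isJ-<3 2 0 _ = s≤s (s≤s (s≤s z≤n)) , s≤s z≤n
  isJ-<3 2 1 _ = s≤s (s≤s (s≤s z≤n)) , s≤s (s≤s z≤n)

  quot-<⇒< : ∀ {m n} k .{{_ : NonZero k}} → quot m k < n → m < n * k
  quot-<⇒< {m} {n} k@(suc _) q<n with m <? n * k
  ... | yes m<nk = m<nk
  ... | no  m≮nk = contradiction
    (≤-<-trans (≤-trans (≤-reflexive (sym (m*n/n≡m n k))) (/-monoˡ-≤ k (≮⇒≥ m≮nk))) q<n) (<-irrefl refl)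

  ∈-region⁺ : ∀ k .{{_ : NonZero k}} {c} → T (inkJ k c) → c ∈ region k
  ∈-region⁺ k {x , y} c∈ with x< , y< ← isJ-<3 (quot x k) (quot y k) c∈ =
    ∈-filter⁺ (T? ∘ inkJ k)
      (∈-cartesianProduct⁺ (∈-upTo⁺ (quot-<⇒< k x<)) (∈-upTo⁺ (quot-<⇒< k y<))) c∈

  ∈-region⁻ : ∀ k {c} → c ∈ region k → T (inkJ k c) × proj₁ c < 3 * k × proj₂ c < 3 * k
  ∈-region⁻ k {c} c∈ with c∈box , c∈kJ ← ∈-filter⁻ (T? ∘ inkJ k) c∈
    with x∈ , y∈ ← ∈-cartesianProduct⁻ (upTo (3 * k)) (upTo (3 * k)) c∈box =
    c∈kJ , ∈-upTo⁻ x∈ , ∈-upTo⁻ y∈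

  rows cols : Cellℕ → ℕ → ℕ → List Cellℕ
  rows o w h = concatMap (λ j → map (λ i → o ⊹ (i , j)) (upTo w)) (downFrom h)
  cols o w h = concatMap (λ i → map (λ j → o ⊹ (i , j)) (downFrom h)) (upTo w)

  -- Sweeping kJ in this order, arm by arm, keeps the number of states small.
  order : ℕ → List Cellℕ
  order k = rows (0 , k) k (2 * k) ++ cols (0 , 0) (2 * k) k
         ++ rows (2 * k , k) k k ++ cols (2 * k , 0) k k

  T-∧∧ : ∀ a b {c} → T (a ∧ b ∧ c) → T a × T b × T c
  T-∧∧ true true t = _ , _ , t

  module SearchkJ (k : ℕ) .{{_ : NonZero k}} (bad : Shape → Cellℕ → Bool) where
    -- Three columns of margin on either side: a placement reaches at most three cells beyond the
    -- cell it covers, so it never wraps into another row.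
    W : ℕ
    W = 6 + 3 * k

    open Search W bad
    open Mask W

    outside : Cellℕ → Bool
    outside (suc (suc (suc x)) , suc (suc (suc y))) = not (inkJ k (x , y))
    outside _ = true

    -- Taken as covered from the start, so that no tile leaves kJ.
    walls : ℕ
    walls = sum (map (λ c → if outside c then pow c else 0) (box W W))

    -- Of the start value `m` only freeness of the cells of kJ is tested. Its digits outside kJ
    -- discard placements that leave kJ, and no tiling of kJ contains one of these.
    check : ℕ → Bool
    check m = all (inkJ k) (order k) ∧ all (λ c → not (has m (c ⊹ margin))) (region k)
            ∧ all (good (region k)) (run candidates (order k) ((m , false) ∷ []))

    check-sound : ∀ m → check m ≡ true → (t : Tiling (region k)) →
      ∀ a → bad (Tiling.shape t a) (Tiling.anchor t a ⊹ margin) ≡ false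
    check-sound m ok t =
      Soundness.sound t narrow mkCandidate-∈ (order k) m
        (All.map (∈-region⁺ k) (all⁺ (inkJ k) (order k) (proj₁ parts)))
        (λ c∈ → Equivalence.to T-not-≡ (All.lookup (all⁺ (λ c → not (has m (c ⊹ margin))) (region k) (proj₁ (proj₂ parts))) c∈))
        (Equivalence.to T-≡ (proj₂ (proj₂ parts)))
      where
      parts = T-∧∧ (all (inkJ k) (order k)) (all (λ c → not (has m (c ⊹ margin))) (region k))
        (Equivalence.from T-≡ ok)
      narrow : ∀ {c} → c ∈ region k → proj₁ (c ⊹ margin) < W
      narrow {c} c∈ = ≤-trans (≤-reflexive (+-comm (suc (proj₁ c)) 3))
        (≤-trans (+-monoʳ-≤ 3 (proj₁ (proj₂ (∈-region⁻ k {c} c∈)))) (m≤n+m (3 + 3 * k) 3))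

  -- The searches for k = 12 and k = 6, and the colouring

  notRectangle : Shape → Cellℕ → Bool
  notRectangle V _ = false
  notRectangle H _ = false
  notRectangle _ _ = true

  search-12J : SearchkJ.check 12 notRectangle (SearchkJ.walls 12 notRectangle) ≡ true
  search-12J = refl

  no-X-in-12J : (t : Tiling (region 12)) → ∀ a → notRectangle (Tiling.shape t a) (Tiling.anchor t a ⊹ margin) ≡ false
  no-X-in-12J = SearchkJ.check-sound 12 notRectangle (SearchkJ.walls 12 notRectangle) search-12J

  -- X-shapes have no admissible corner, so `misplaced` flags all of them, and one search excludes
  -- them together with every displaced rectangle.
  corners : Shape → List Cellℕ
  corners V = map (λ (i , j) → (3 * i , 6 + 4 * j)) (box 2 3) ++ map (λ (i , j) → (12 + 3 * i , 4 * j)) (box 2 3)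
  corners H = map (λ (i , j) → (4 * i , 3 * j)) (box 3 2)
  corners _ = []

  open DecMembership (≡-dec _≟_ _≟_) public using () renaming (_∈?_ to _∈ℕ?_)

  misplaced : Shape → Cellℕ → Bool
  misplaced s c = not (does (c ∈ℕ? map (_⊹ margin) (corners s)))

  search-6J : SearchkJ.check 6 misplaced (SearchkJ.walls 6 misplaced) ≡ true
  search-6J = refl

  misplaced-sound : ∀ s c → misplaced s (c ⊹ margin) ≡ false → c ∈ corners s
  misplaced-sound s c eq with c ⊹ margin ∈ℕ? map (_⊹ margin) (corners s)
  ... | yes c∈ with d , d∈ , eq ← ∈-map⁻ (_⊹ margin) c∈ =
    subst (_∈ corners s) (⊹-cancelʳ margin (sym eq)) d∈

  corners-in-6J : (t : Tiling (region 6)) → ∀ a → Tiling.anchor t a ∈ corners (Tiling.shape t a)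
  corners-in-6J t a = misplaced-sound (Tiling.shape t a) (Tiling.anchor t a)
    (SearchkJ.check-sound 6 misplaced (SearchkJ.walls 6 misplaced) search-6J t a)

  -- Colour the cell (x , y) by x - y ≡ x + 2 y modulo 3.
  coloured : ℕ → Cellℕ → ℕ
  coloured r (x , y) = if (x + 2 * y) % 3 ≡ᵇ r then 1 else 0

  count : ℕ → List Cellℕ → ℕ
  count r cs = sum (map (coloured r) cs)

  count-++ : ∀ r cs ds → count r (cs ++ ds) ≡ count r cs + count r ds
  count-++ r cs ds = trans (cong sum (map-++ (coloured r) cs ds))
    (sum-++ (map (coloured r) cs) (map (coloured r) ds))

  -- The class of an anchor is all that matters, so it may be moved to one of three cells on the
  -- horizontal axis. This leaves 6 · 3 cases for `balanced`.
  coloured-⊹ : ∀ r x y d → coloured r ((x , y) ⊹ d) ≡ coloured r (((x + 2 * y) % 3 , 0) ⊹ d)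
  coloured-⊹ r x y (a , b) = cong (λ n → if n ≡ᵇ r then 1 else 0) (begin
    (x + a + 2 * (y + b)) % 3            ≡⟨ cong (_% 3) (rearrange x y a b) ⟩
    (n + (a + 2 * b)) % 3                ≡⟨ %-distribˡ-+ n (a + 2 * b) 3 ⟩
    (n % 3 + (a + 2 * b) % 3) % 3        ≡⟨ cong (λ m → (m + (a + 2 * b) % 3) % 3) (m%n%n≡m%n n 3) ⟨
    (n % 3 % 3 + (a + 2 * b) % 3) % 3    ≡⟨ %-distribˡ-+ (n % 3) (a + 2 * b) 3 ⟨
    (n % 3 + (a + 2 * b)) % 3            ≡⟨ cong (_% 3) (+-assoc (n % 3) a (2 * b)) ⟨
    (n % 3 + a + 2 * b) % 3              ∎)
    where
    open ≡-Reasoning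
    n = x + 2 * y
    rearrange : ∀ x y a b → x + a + 2 * (y + b) ≡ x + 2 * y + (a + 2 * b)
    rearrange = solve-∀

  balanced : ∀ s o → count 0 (place s o) ≡ count 1 (place s o)
  balanced s o@(x , y) = trans (reduce 0) (trans (cases s ((x + 2 * y) % 3) (m%n<n (x + 2 * y) 3)) (sym (reduce 1)))
    where
    reduce : ∀ r → count r (place s o) ≡ count r (place s ((x + 2 * y) % 3 , 0))
    reduce r = cong sum (trans (sym (map-∘ (cellsOf s)))
      (trans (map-cong (coloured-⊹ r x y) (cellsOf s)) (map-∘ (cellsOf s))))
    cases : ∀ s n → n < 3 → count 0 (place s (n , 0)) ≡ count 1 (place s (n , 0))
    cases V  0 _ = refl
    cases V  1 _ = refl
    cases V  2 _ = refl
    cases H  0 _ = refl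
    cases H  1 _ = refl
    cases H  2 _ = refl
    cases X₁ 0 _ = refl
    cases X₁ 1 _ = refl
    cases X₁ 2 _ = refl
    cases X₂ 0 _ = refl
    cases X₂ 1 _ = refl
    cases X₂ 2 _ = refl
    cases X₃ 0 _ = refl
    cases X₃ 1 _ = refl
    cases X₃ 2 _ = refl
    cases X₄ 0 _ = refl
    cases X₄ 1 _ = refl
    cases X₄ 2 _ = refl
    cases _ (suc (suc (suc _))) (s≤s (s≤s (s≤s ())))

  count-concat : ∀ {css} → All (λ cs → count 0 cs ≡ count 1 cs) css →
                 count 0 (concat css) ≡ count 1 (concat css)
  count-concat {[]}       []         = refl
  count-concat {cs ∷ css} (eq ∷ eqs) = trans (count-++ 0 cs (concat css))
    (trans (cong₂ _+_ eq (count-concat eqs)) (sym (count-++ 1 cs (concat css))))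

  -- `R` and the concatenation of the tiles have the same members and no repetitions, so they are
  -- permutations of each other and the counts of the tiles add up.
  region-balanced : ∀ {R} → Unique R → Tiling R → count 0 R ≡ count 1 R
  region-balanced {R} R! t = trans (same 0) (trans (count-concat (All.tabulate⁺ balanced-tile)) (sym (same 1)))
    where
    open Tiling t
    tiles = tabulate tile
    balanced-tile : ∀ a → count 0 (tile a) ≡ count 1 (tile a)
    balanced-tile a = balanced (shape a) (anchor a)
    tiles! : Unique (concat tiles)
    tiles! = Unique.concat⁺ (All.tabulate⁺ (λ a → place-unique (shape a) (anchor a)))
      (AllPairs.tabulate⁺ (λ a≢b (∈a , ∈b) → a≢b (apart ∈a ∈b)))
    R↭tiles : R ↭ concat tiles
    R↭tiles = ∼bag⇒↭ (unique∧set⇒bag R! tiles! (mk⇔ to from))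
      where
      to : ∀ {c} → c ∈ R → c ∈ concat tiles
      to c∈ with a , c∈a ← covers c∈ = ∈-concat⁺′ c∈a (∈-tabulate⁺ a)
      from : ∀ {c} → c ∈ concat tiles → c ∈ R
      from c∈ with _ , c∈xs , xs∈ ← ∈-concat⁻′ tiles c∈ with a , refl ← ∈-tabulate⁻ xs∈ = inside a c∈xs
    same : ∀ r → count r R ≡ count r (concat tiles)
    same r = sum-↭ (Perm.map⁺ (coloured r) R↭tiles)

  -- Cutting off rectangles with a side divisible by 3 shows that each k × k block has one extra
  -- cell, in the class of its lower left corner. That corner has class `k (a - b)` for a cell
  -- `(a , b)` of J, so the classes 0, k and 2k get 1, 3 and 2 extra cells.
  unbalanced : All (λ k → count 0 (region k) ≢ count 1 (region k)) (2 ∷ 4 ∷ 8 ∷ 10 ∷ 14 ∷ 16 ∷ 20 ∷ 22 ∷ [])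
  unbalanced = (λ ()) ∷ (λ ()) ∷ (λ ()) ∷ (λ ()) ∷ (λ ()) ∷ (λ ()) ∷ (λ ()) ∷ (λ ()) ∷ []

open Counting

open import Data.Integer.Base using (ℤ; +_; -[1+_]; -1ℤ; 1ℤ; -_; _+_; _*_; _-_; _≤_; _<_; ∣_∣; +≤+; +<+)
import Data.Integer.Properties as ℤ
open import Data.Integer.Tactic.RingSolver using (solve-∀)
import Data.Nat.Base as ℕ
import Data.Nat.Properties as ℕ

open Isometry using (transpose; flipX; flipY; shiftX; shiftY)

-- The group of symmetries of the grid

infixl 6 _⊕_
_⊕_ : Cell → Cell → Cell
(x , y) ⊕ (a , b) = (x + a , y + b)

negIf : Bool → ℤ → ℤ
negIf b z = if b then - z else z

negIf-+ : ∀ b z w s → negIf b (z + w) + s ≡ negIf b z + s + negIf b w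
negIf-+ false = lemma
  where
  lemma : ∀ z w s → z + w + s ≡ z + s + w
  lemma = solve-∀
negIf-+ true  = lemma
  where
  lemma : ∀ z w s → - (z + w) + s ≡ - z + s + - w
  lemma = solve-∀

negIf-inverseˡ : ∀ b z s → negIf b (negIf b z + - negIf b s) + s ≡ z
negIf-inverseˡ false = lemma
  where
  lemma : ∀ z s → z + - s + s ≡ z
  lemma = solve-∀
negIf-inverseˡ true  = lemma
  where
  lemma : ∀ z s → - (- z + - (- s)) + s ≡ z
  lemma = solve-∀

negIf-inverseʳ : ∀ b z s → negIf b (negIf b z + s) + - negIf b s ≡ z
negIf-inverseʳ false = lemma
  where
  lemma : ∀ z s → z + s + - s ≡ z
  lemma = solve-∀
negIf-inverseʳ true  = lemma
  where
  lemma : ∀ z s → - (- z + s) + - (- s) ≡ z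
  lemma = solve-∀

negIf-xor : ∀ a b z r s → negIf (a xor b) z + (negIf a s + r) ≡ negIf a (negIf b z + s) + r
negIf-xor false false = lemma
  where
  lemma : ∀ z r s → z + (s + r) ≡ z + s + r
  lemma = solve-∀
negIf-xor false true  = lemma
  where
  lemma : ∀ z r s → - z + (s + r) ≡ - z + s + r
  lemma = solve-∀
negIf-xor true  false = lemma
  where
  lemma : ∀ z r s → - z + (- s + r) ≡ - (z + s) + r
  lemma = solve-∀
negIf-xor true  true  = lemma
  where
  lemma : ∀ z r s → z + (- s + r) ≡ - (- z + s) + r
  lemma = solve-∀

linear : Isometry → Cell → Cell
linear g c = let (x , y) = Isometry.linear g c in negIf (flipX g) x , negIf (flipY g) y

shift : Isometry → Cell
shift g = shiftX g , shiftY g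

act-⊕ : ∀ g c u → act g (c ⊕ u) ≡ act g c ⊕ linear g u
act-⊕ g (x , y) (u , v) with transpose g
... | false = cong₂ _,_ (negIf-+ (flipX g) x u (shiftX g)) (negIf-+ (flipY g) y v (shiftY g))
... | true  = cong₂ _,_ (negIf-+ (flipX g) y v (shiftX g)) (negIf-+ (flipY g) x u (shiftY g))

infix 10 _⁻¹
-- Flips and shifts are applied after the transposition; undoing them before it makes the two axes
-- change roles.
_⁻¹ : Isometry → Isometry
g ⁻¹ = record
  { transpose = transpose g
  ; flipX     = fx
  ; flipY     = fy
  ; shiftX    = - negIf fx (if transpose g then shiftY g else shiftX g)
  ; shiftY    = - negIf fy (if transpose g then shiftX g else shiftY g)
  }
  where
  fx = if transpose g then flipY g else flipX g
  fy = if transpose g then flipX g else flipY g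

act-inverseˡ : ∀ g c → act g (act (g ⁻¹) c) ≡ c
act-inverseˡ g (x , y) with transpose g
... | false = cong₂ _,_ (negIf-inverseˡ (flipX g) x (shiftX g)) (negIf-inverseˡ (flipY g) y (shiftY g))
... | true  = cong₂ _,_ (negIf-inverseˡ (flipX g) x (shiftX g)) (negIf-inverseˡ (flipY g) y (shiftY g))

act-inverseʳ : ∀ g c → act (g ⁻¹) (act g c) ≡ c
act-inverseʳ g (x , y) with transpose g
... | false = cong₂ _,_ (negIf-inverseʳ (flipX g) x (shiftX g)) (negIf-inverseʳ (flipY g) y (shiftY g))
... | true  = cong₂ _,_ (negIf-inverseʳ (flipY g) x (shiftY g)) (negIf-inverseʳ (flipX g) y (shiftX g))

act-injective : ∀ g {c d} → act g c ≡ act g d → c ≡ d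
act-injective g {c} {d} eq =
  trans (sym (act-inverseʳ g c)) (trans (cong (act (g ⁻¹)) eq) (act-inverseʳ g d))

infixr 9 _∙_
_∙_ : Isometry → Isometry → Isometry
g ∙ h = record
  { transpose = transpose g xor transpose h
  ; flipX     = flipX g xor (if transpose g then flipY h else flipX h)
  ; flipY     = flipY g xor (if transpose g then flipX h else flipY h)
  ; shiftX    = proj₁ (act g (shift h))
  ; shiftY    = proj₂ (act g (shift h))
  }

act-∙ : ∀ g h c → act (g ∙ h) c ≡ act g (act h c)
act-∙ g h (x , y) with transpose g | transpose h
... | false | false = cong₂ _,_ (negIf-xor (flipX g) (flipX h) x (shiftX g) (shiftX h)) (negIf-xor (flipY g) (flipY h) y (shiftY g) (shiftY h))
... | false | true  = cong₂ _,_ (negIf-xor (flipX g) (flipX h) y (shiftX g) (shiftX h)) (negIf-xor (flipY g) (flipY h) x (shiftY g) (shiftY h))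
... | true  | false = cong₂ _,_ (negIf-xor (flipX g) (flipY h) y (shiftX g) (shiftY h)) (negIf-xor (flipY g) (flipX h) x (shiftY g) (shiftX h))
... | true  | true  = cong₂ _,_ (negIf-xor (flipX g) (flipY h) x (shiftX g) (shiftY h)) (negIf-xor (flipY g) (flipX h) y (shiftY g) (shiftX h))

image-∙ : ∀ g h P → image (g ∙ h) P ≐ image g (image h P)
image-∙ g h P =
  (λ { (d , d∈ , eq) → act h d , (d , d∈ , refl) , trans (sym (act-∙ g h d)) eq }) ,
  (λ { (_ , (d , d∈ , refl) , eq) → d , d∈ , trans (act-∙ g h d) eq })

image-cong : ∀ g {P Q} → P ≐ Q → image g P ≐ image g Q
image-cong g (P⊆Q , Q⊆P) =
  (λ { (d , d∈ , eq) → d , P⊆Q d∈ , eq }) , (λ { (d , d∈ , eq) → d , Q⊆P d∈ , eq })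

image-act⁻ : ∀ g P {c} → image g P (act g c) → P c
image-act⁻ g P (d , d∈ , eq) = subst P (act-injective g eq) d∈

_≟_ : DecidableEquality Cell
_≟_ = Product.≡-dec ℤ._≟_ ℤ._≟_

open DecMembership _≟_ using (_∈?_; _∉?_)

-- The ways to fill the notch of J

data Kind : Set where
  rec cross : Kind

pair : Kind → Pair
pair rec   = J-rec
pair cross = J-X

J-cells : List Cell
J-cells = (+ 0 , + 0) ∷ (+ 0 , + 1) ∷ (+ 0 , + 2) ∷ (+ 1 , + 0) ∷ (+ 2 , + 0) ∷ (+ 2 , + 1) ∷ []

partner-cells : Kind → List Cell
partner-cells rec   = (+ 1 , + 1) ∷ (+ 1 , + 2) ∷ (+ 2 , + 2) ∷ (+ 3 , + 0) ∷ (+ 3 , + 1) ∷ (+ 3 , + 2) ∷ []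
partner-cells cross = (+ 1 , + 1) ∷ (+ 1 , + 2) ∷ (+ 1 , + 3) ∷ (+ 0 , + 3) ∷ (-1ℤ , + 3) ∷ (-1ℤ , + 2) ∷ []

pair-zero : ∀ K → pair K zero ≐ cells J-cells
pair-zero rec   = id , id
pair-zero cross = id , id

pair-suc : ∀ K → pair K (suc zero) ≐ cells (partner-cells K)
pair-suc rec   = id , id
pair-suc cross = id , id

-- The cell of the notch of J, and the cell that would be enclosed if the notch
-- were filled by the long arm of a copy of J bending to the right.
notch hole : Cell
notch = (+ 1 , + 1)
hole  = (+ 2 , + 2)

notch∉J : notch ∉ J-cells
notch∉J (there (there (there (there (there (there ()))))))

hole∉J : hole ∉ J-cells
hole∉J (there (there (there (there (there (there ()))))))

neighbours : Cell → List Cell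
neighbours c = map (c ⊕_) ((+ 1 , + 0) ∷ (-1ℤ , + 0) ∷ (+ 0 , + 1) ∷ (+ 0 , -1ℤ) ∷ [])

-- `h` is the position of the second piece when the first one is `J`. The cells (1 , 2) and (3 , 2)
-- in `Enclosing` flank the hole, so gaplessness will put the hole into the region.
Overlap Enclosing : Isometry → Set
Overlap h = Any (λ d → act h d ∈ J-cells) J-cells
Enclosing h =
  (+ 1 , + 2) ∈ map (act h) J-cells × (+ 3 , + 2) ∈ map (act h) J-cells ×
  All (λ e → e ∈ J-cells ⊎ e ∈ map (act h) J-cells) (neighbours hole) ×
  hole ∉ map (act h) J-cells

-- The last clause records that the notch is filled in return, which makes the assignment of
-- partners an involution.
Partner : Kind → Isometry → Set
Partner K h =
  All (λ d → act h d ∈ partner-cells K) J-cells ×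
  All (λ c → c ∈ map (act h) J-cells) (partner-cells K) ×
  act h notch ∈ J-cells

Outcome : Isometry → Set
Outcome h = Overlap h ⊎ Enclosing h ⊎ Partner rec h ⊎ Partner cross h

overlap? : ∀ h → Dec (Overlap h)
overlap? h = any? (λ d → act h d ∈? J-cells) J-cells

enclosing? : ∀ h → Dec (Enclosing h)
enclosing? h =
  ((+ 1 , + 2) ∈? map (act h) J-cells) ×-dec ((+ 3 , + 2) ∈? map (act h) J-cells) ×-dec
  all? (λ e → (e ∈? J-cells) ⊎-dec (e ∈? map (act h) J-cells)) (neighbours hole) ×-dec
  (hole ∉? map (act h) J-cells)

partner? : ∀ K h → Dec (Partner K h)
partner? K h =
  all? (λ d → act h d ∈? partner-cells K) J-cells ×-dec
  all? (λ c → c ∈? map (act h) J-cells) (partner-cells K) ×-dec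
  (act h notch ∈? J-cells)

outcome? : ∀ h → Dec (Outcome h)
outcome? h = overlap? h ⊎-dec enclosing? h ⊎-dec partner? rec h ⊎-dec partner? cross h

bools : List Bool
bools = false ∷ true ∷ []

∈-bools : ∀ b → b ∈ bools
∈-bools false = here refl
∈-bools true  = there (here refl)

∀-bools : ∀ {P : Bool → Bool → Bool → Set} →
          All (λ t → All (λ a → All (P t a) bools) bools) bools → ∀ t a b → P t a b
∀-bools all t a b = All.lookup (All.lookup (All.lookup all (∈-bools t)) (∈-bools a)) (∈-bools b)

isometry : (t a b : Bool) → Cell → Isometry
isometry t a b (x , y) = record
  { transpose = t ; flipX = a ; flipY = b ; shiftX = x ; shiftY = y }

moving : (t a b : Bool) (d c : Cell) → Isometry
moving t a b d (x , y) =
  let (u , v) = linear (isometry t a b (+ 0 , + 0)) d in isometry t a b (x - u , y - v)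

≡moving : ∀ t a b s d {c} → act (isometry t a b s) d ≡ c → isometry t a b s ≡ moving t a b d c
≡moving t a b (x , y) d refl =
  cong₂ (λ x y → isometry t a b (x , y)) (lemma (proj₁ u) x) (lemma (proj₂ u) y)
  where
  u = linear (isometry t a b (+ 0 , + 0)) d
  lemma : ∀ u s → s ≡ u + s - u
  lemma = solve-∀

-- An isometry is determined by its linear part and the cell of `J` that it takes to the notch,
-- which leaves 8 · 6 cases to decide.
notch-filling : ∀ h {d} → d ∈ J-cells → act h d ≡ notch → Outcome h
notch-filling h {d} d∈ eq = subst Outcome (sym (≡moving t a b (shift h) d eq))
  (All.lookup (∀-bools {λ t a b → All (λ d → Outcome (moving t a b d notch)) J-cells} checked t a b) d∈)
  where
  open Isometry h renaming (transpose to t; flipX to a; flipY to b)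
  checked = from-yes (all? (λ t → all? (λ a → all? (λ b → all? (λ d →
    outcome? (moving t a b d notch)) J-cells) bools) bools) bools)

opposites : List (Cell × Cell)
opposites = ((+ 1 , + 0) , (-1ℤ , + 0)) ∷ ((-1ℤ , + 0) , (+ 1 , + 0))
          ∷ ((+ 0 , + 1) , (+ 0 , -1ℤ)) ∷ ((+ 0 , -1ℤ) , (+ 0 , + 1)) ∷ []

linear-opposite : ∀ g {u v} → (u , v) ∈ opposites → (linear g u , linear g v) ∈ opposites
linear-opposite g = All.lookup (∀-bools checked (transpose g) (flipX g) (flipY g))
  where
  open Isometry using (transpose; flipX; flipY)
  _≟₂_ : DecidableEquality (Cell × Cell)
  _≟₂_ = Product.≡-dec _≟_ _≟_
  open DecMembership _≟₂_ using () renaming (_∈?_ to _∈₂?_)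
  lin : (t a b : Bool) → Cell → Cell
  lin t a b = linear (isometry t a b (+ 0 , + 0))
  checked : All (λ t → All (λ a → All (λ b →
    All (λ p → (lin t a b (proj₁ p) , lin t a b (proj₂ p)) ∈ opposites) opposites) bools) bools) bools
  checked = from-yes (all? (λ t → all? (λ a → all? (λ b →
    all? (λ p → (lin t a b (proj₁ p) , lin t a b (proj₂ p)) ∈₂? opposites) opposites) bools) bools) bools)

act-neighbour : ∀ g {c d} → d ∈ neighbours c → act g d ∈ neighbours (act g c)
act-neighbour g {c} d∈ with u , u∈ , refl ← ∈-map⁻ (c ⊕_) d∈ =
  subst (_∈ neighbours (act g c)) (sym (act-⊕ g c u)) (∈-map⁺ (act g c ⊕_) (unit u∈))
  where
  units = map proj₁ opposites
  unit : ∀ {u} → u ∈ units → linear g u ∈ units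
  unit u∈ with (u , v) , uv∈ , refl ← ∈-map⁻ proj₁ {xs = opposites} u∈ = ∈-map⁺ proj₁ (linear-opposite g uv∈)

J-connected : ∀ {d} → d ∈ J-cells → ∃[ e ] e ∈ J-cells × e ∈ neighbours d
J-connected d∈ = find (All.lookup checked d∈)
  where
  checked : All (λ d → Any (_∈ neighbours d) J-cells) J-cells
  checked = from-yes (all? (λ d → any? (_∈? neighbours d) J-cells) J-cells)

-- Two cells of a gapless region on both sides of a cell force that cell.
Gapless : Region → Set
Gapless R = ∀ c {u v} → (u , v) ∈ opposites → R (c ⊕ u) → R (c ⊕ v) → R c

gapless-act : ∀ g {R} → Gapless R → Gapless (R ∘ act g)
gapless-act g {R} gapless c {u} {v} uv∈ Ru Rv = gapless (act g c) (linear-opposite g uv∈)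
  (subst R (act-⊕ g c u) Ru) (subst R (act-⊕ g c v) Rv)

-- From a fixed-point-free involution to numbered pairs

lookup-injective : ∀ {A : Set} {xs : List A} → Unique xs → ∀ i j → lookup xs i ≡ lookup xs j → i ≡ j
lookup-injective (_ ∷ _)  zero    zero    _  = refl
lookup-injective (x∉ ∷ _) zero    (suc j) eq = contradiction eq (All.lookup x∉ (∈-lookup j))
lookup-injective (x∉ ∷ _) (suc i) zero    eq = contradiction (sym eq) (All.lookup x∉ (∈-lookup i))
lookup-injective (_ ∷ u)  (suc i) (suc j) eq = cong suc (lookup-injective u i j eq)

record Matching {n : ℕ} (σ : Fin n → Fin n) : Set where
  field
    size      : ℕ
    matched   : Fin n ↔ (Fin size × Fin 2)

  open Inverse matched public using (to; from)

  field
    from-partner : ∀ a → from (a , suc zero) ≡ σ (from (a , zero))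

  even : n ≡ size ℕ.* 2
  even = ↔⇒≡ (↔-sym Fin.*↔× ↔-∘ matched)

-- Each pair is represented by its smaller index, which becomes its member `zero`.
matching : ∀ {n} (σ : Fin n → Fin n) → (∀ i → σ (σ i) ≡ i) → (∀ i → σ i ≢ i) → Matching σ
matching {n} σ σσ σ≢ = record
  { size = length firsts
  ; matched = mk↔ₛ′ to from to∘from from∘to
  ; from-partner = λ _ → refl
  }
  where
  first? = λ i → i Fin.<? σ i
  firsts = filter first? (allFin n)

  first : ∀ a → lookup firsts a Fin.< σ (lookup firsts a)
  first a = proj₂ (∈-filter⁻ first? {xs = allFin n} (∈-lookup a))

  locate : ∀ {i} → i Fin.< σ i → ∃[ a ] lookup firsts a ≡ i
  locate {i} i<σi = Any.index i∈ , sym (lookup-index i∈)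
    where i∈ = ∈-filter⁺ first? (∈-allFin i) i<σi

  to : Fin n → Fin (length firsts) × Fin 2
  to i with Fin.<-cmp i (σ i)
  ... | tri< i<σi _ _ = proj₁ (locate i<σi) , zero
  ... | tri≈ _ i≡σi _ = contradiction (sym i≡σi) (σ≢ i)
  ... | tri> _ _ σi<i = proj₁ (locate (subst (σ i Fin.<_) (sym (σσ i)) σi<i)) , suc zero

  from : Fin (length firsts) × Fin 2 → Fin n
  from (a , zero)     = lookup firsts a
  from (a , suc zero) = σ (lookup firsts a)

  from∘to : ∀ i → from (to i) ≡ i
  from∘to i with Fin.<-cmp i (σ i)
  ... | tri< i<σi _ _ = proj₂ (locate i<σi)
  ... | tri≈ _ i≡σi _ = contradiction (sym i≡σi) (σ≢ i)
  ... | tri> _ _ σi<i = trans (cong σ (proj₂ (locate (subst (σ i Fin.<_) (sym (σσ i)) σi<i)))) (σσ i)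

  found : ∀ {i} (i<σi : i Fin.< σ i) a → lookup firsts a ≡ i → proj₁ (locate i<σi) ≡ a
  found i<σi a eq = lookup-injective (Unique.filter⁺ first? (Unique.allFin⁺ n)) _ a
    (trans (proj₂ (locate i<σi)) (sym eq))

  to∘from : ∀ ab → to (from ab) ≡ ab
  to∘from (a , zero) with Fin.<-cmp (lookup firsts a) (σ (lookup firsts a))
  ... | tri< i<σi _ _ = cong (_, zero) (found i<σi a refl)
  ... | tri≈ ¬i<σi _ _ = contradiction (first a) ¬i<σi
  ... | tri> ¬i<σi _ _ = contradiction (first a) ¬i<σi
  to∘from (a , suc zero) with Fin.<-cmp (σ (lookup firsts a)) (σ (σ (lookup firsts a)))
  ... | tri< _ _ ¬σσi<σi = contradiction (subst (Fin._< σ (lookup firsts a)) (sym (σσ _)) (first a)) ¬σσi<σi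
  ... | tri≈ _ _ ¬σσi<σi = contradiction (subst (Fin._< σ (lookup firsts a)) (sym (σσ _)) (first a)) ¬σσi<σi
  ... | tri> _ _ σσi<σi = cong (_, suc zero) (found _ a (sym (σσ _)))

-- Matching the pieces of a gapless region

record Pairing {n : ℕ} (p : Fin n → Region) : Set₁ where
  field
    size    : ℕ
    even    : n ≡ size ℕ.* 2
    matched : Fin n ↔ (Fin size × Fin 2)

  open Inverse matched public using (to; from; strictlyInverseˡ; strictlyInverseʳ)

  field
    kind   : Fin size → Kind
    motion : Fin size → Isometry
    pieces : ∀ a b → p (from (a , b)) ≐ image (motion a) (pair (kind a) b)

same-index : ∀ {m R} {q : Fin m → Region} → Dissects R q → ∀ {i j c} → q i c → q j c → i ≡ j
same-index (_ , apart) {i} {j} qi qj with i Fin.≟ j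
... | yes i≡j = i≡j
... | no  i≢j = ⊥-elim (apart i≢j (qi , qj))

fromMatching : ∀ {n} {p : Fin n → Region} {σ : Fin n → Fin n} → Matching σ →
  (kind : Fin n → Kind) (motion : Fin n → Isometry) →
  (∀ i → image (motion i) J ≐ p i) →
  (∀ i → p (σ i) ≐ image (motion i) (pair (kind i) (suc zero))) → Pairing p
fromMatching {p = p} m kind motion piece piece′ = record
  { size    = size
  ; even    = even
  ; matched = matched
  ; kind    = λ a → kind (from (a , zero))
  ; motion  = λ a → motion (from (a , zero))
  ; pieces  = pieces
  }
  where
  open Matching m
  pieces : ∀ a b → p (from (a , b)) ≐ image (motion (from (a , zero))) (pair (kind (from (a , zero))) b)
  pieces a zero = ≐-sym (≐-trans
    (image-cong (motion (from (a , zero))) (pair-zero (kind (from (a , zero)))))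
    (piece (from (a , zero))))
  pieces a (suc zero) = subst (λ j → p j ≐ _) (sym (from-partner a)) (piece′ (from (a , zero)))

module _ {n : ℕ} {R : Region} {p : Fin n → Region} (gapless : Gapless R)
         (congruent : ∀ i → Congruent J (p i)) (dissects : Dissects R p) where
  private
    motion : Fin n → Isometry
    motion i = proj₁ (congruent i)

    p⁺ : ∀ i {d} → d ∈ J-cells → p i (act (motion i) d)
    p⁺ i d∈ = proj₁ (proj₂ (congruent i)) (_ , d∈ , refl)

    p⁻ : ∀ i {c} → p i c → ∃[ d ] d ∈ J-cells × act (motion i) d ≡ c
    p⁻ i = proj₂ (proj₂ (congruent i))

    p-act⁻ : ∀ i {d} → p i (act (motion i) d) → d ∈ J-cells
    p-act⁻ i pi = image-act⁻ (motion i) (_∈ J-cells) (p⁻ i pi)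

    owner : ∀ {c} → R c → ∃[ i ] p i c
    owner = proj₁ (proj₁ dissects)

    inR : ∀ i {c} → p i c → R c
    inR i pi = proj₂ (proj₁ dissects) (i , pi)

    same : ∀ {i j c} → p i c → p j c → i ≡ j
    same = same-index dissects

    notch-in-R : ∀ i → R (act (motion i) notch)
    -- The cells (2 , 1) and (0 , 1) of `J` flank the notch.
    notch-in-R i = gapless-act (motion i) gapless notch (here refl)
      (inR i (p⁺ i (there (there (there (there (there (here refl))))))))
      (inR i (p⁺ i (there (here refl))))

    partner : Fin n → Fin n
    partner i = proj₁ (owner (notch-in-R i))

    -- The position of piece `j` in the frame in which piece `i` is `J` itself.
    relative : Fin n → Fin n → Isometry
    relative i j = motion i ⁻¹ ∙ motion j

    act-relative : ∀ i j d → act (motion i) (act (relative i j) d) ≡ act (motion j) d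
    act-relative i j d =
      trans (cong (act (motion i)) (act-∙ (motion i ⁻¹) (motion j) d)) (act-inverseˡ (motion i) _)

    relative-⁺ : ∀ i j {c} → c ∈ map (act (relative i j)) J-cells → p j (act (motion i) c)
    relative-⁺ i j c∈ with d , d∈ , refl ← ∈-map⁻ (act (relative i j)) {xs = J-cells} c∈ =
      subst (p j) (sym (act-relative i j d)) (p⁺ j d∈)

    relative-⁻ : ∀ i j {c} → p j (act (motion i) c) → c ∈ map (act (relative i j)) J-cells
    relative-⁻ i j {c} pj with d , d∈ , eq ← p⁻ j pj =
      subst (_∈ map (act (relative i j)) J-cells)
        (act-injective (motion i) (trans (act-relative i j d) eq)) (∈-map⁺ (act (relative i j)) d∈)

    partner-≢ : ∀ i → i ≢ partner i
    partner-≢ i i≡j = notch∉J (p-act⁻ i (subst (λ j → p j (act (motion i) notch)) (sym i≡j)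
      (proj₂ (owner (notch-in-R i)))))

    disjoint : ∀ i j → i ≢ j → ¬ Overlap (relative i j)
    disjoint i j i≢j meets with d , d∈ , hd∈ ← find meets =
      i≢j (same {c = act (motion i) (act (relative i j) d)} (p⁺ i hd∈)
        (subst (p j) (sym (act-relative i j d)) (p⁺ j d∈)))

    -- The cell in the hole would lie in a piece with one of its neighbours, so
    -- in one of the two pieces around the hole.
    no-hole : ∀ i j → ¬ Enclosing (relative i j)
    no-hole i j (left , right , around , hole∉)
      with l , pl ← owner (gapless-act (motion i) gapless hole (here refl)
        (inR j (relative-⁺ i j right)) (inR j (relative-⁺ i j left)))
      with d , d∈ , eq ← p⁻ l pl
      with e , e∈ , adj ← J-connected d∈ = surrounded (All.lookup around neighbour)
      where
      m = relative i l
      md≡hole : act m d ≡ hole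
      md≡hole = act-injective (motion i) (trans (act-relative i l d) eq)
      neighbour : act m e ∈ neighbours hole
      neighbour = subst (λ c → act m e ∈ neighbours c) md≡hole (act-neighbour m adj)
      pl-e : p l (act (motion i) (act m e))
      pl-e = subst (p l) (sym (act-relative i l e)) (p⁺ l e∈)
      surrounded : act m e ∈ J-cells ⊎ act m e ∈ map (act (relative i j)) J-cells → ⊥
      surrounded (inj₁ e∈i) with refl ← same pl-e (p⁺ i e∈i) =
        hole∉J (p-act⁻ i pl)
      surrounded (inj₂ e∈j) with refl ← same pl-e (relative-⁺ i j e∈j) =
        hole∉ (relative-⁻ i j pl)

    partner-outcome : ∀ i → ∃[ K ] Partner K (relative i (partner i))
    partner-outcome i = resolve (partner-≢ i) (notch-filling (relative i j) d∈
      (act-injective (motion i) (trans (act-relative i j d) eq)))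
      where
      j = partner i
      in-notch = p⁻ j (proj₂ (owner (notch-in-R i)))
      d = proj₁ in-notch
      d∈ = proj₁ (proj₂ in-notch)
      eq = proj₂ (proj₂ in-notch)
      resolve : ∀ {j} → i ≢ j → Outcome (relative i j) → ∃[ K ] Partner K (relative i j)
      resolve {j} i≢j (inj₁ meets)       = contradiction meets (disjoint i j i≢j)
      resolve {j} _ (inj₂ (inj₁ enclosing))  = contradiction enclosing (no-hole i j)
      resolve _ (inj₂ (inj₂ (inj₁ isRec)))   = rec , isRec
      resolve _ (inj₂ (inj₂ (inj₂ isCross))) = cross , isCross

    -- The notch of the partner lies in piece `i` by the last clause of `Partner`, and only one
    -- piece owns that cell.
    partner-involutive : ∀ i → partner (partner i) ≡ i
    partner-involutive i =
      same {c = act (motion j) notch} (proj₂ (owner (notch-in-R j)))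
        (subst (p i) (act-relative i j notch)
          (p⁺ i {act (relative i j) notch} (proj₂ (proj₂ (proj₂ (partner-outcome i))))))
      where j = partner i

    filled : ∀ i j K → Partner K (relative i j) → p j ≐ image (motion i) (pair K (suc zero))
    filled i j K (⊆K , K⊆ , _) = to , from
      where
      to : ∀ {c} → p j c → image (motion i) (pair K (suc zero)) c
      to {c} pj = act (relative i j) d , proj₂ (pair-suc K) (All.lookup ⊆K (proj₁ (proj₂ (p⁻ j pj)))) ,
                  trans (act-relative i j d) (proj₂ (proj₂ (p⁻ j pj)))
        where d = proj₁ (p⁻ j pj)
      from : ∀ {c} → image (motion i) (pair K (suc zero)) c → p j c
      from (d , d∈ , eq) = subst (p j) eq (relative-⁺ i j {d} (All.lookup K⊆ (proj₁ (pair-suc K) d∈)))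

    partner-piece : ∀ i → p (partner i) ≐ image (motion i) (pair (proj₁ (partner-outcome i)) (suc zero))
    partner-piece i = filled i (partner i) _ (proj₂ (partner-outcome i))

  pairing : Pairing p
  pairing = fromMatching (matching partner partner-involutive (λ i eq → partner-≢ i (sym eq)))
    (λ i → proj₁ (partner-outcome i)) motion (λ i → proj₂ (congruent i)) partner-piece

-- Magnified regions are gapless

InBlock : ℕ → ℤ → ℤ → Set
InBlock k a z = + k * a ≤ z × z < + k * a + + k

-- If `z` were in neither block, block `a` would start at `z + 1` and block `b` would end just
-- before `z`. Then `k * (a - b - 1) ≡ 1`, which forces `k ≡ 1`.
between : ∀ k → 2 ℕ.≤ k → ∀ a b z → InBlock k a (z + 1ℤ) → InBlock k b (z + -1ℤ) →
          InBlock k a z ⊎ InBlock k b z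
between k 2≤k a b z (ka≤z+1 , z+1<) (kb≤z-1 , z-1<) with + k * a ℤ.≤? z | z ℤ.<? + k * b + + k
... | yes ka≤z | _       = inj₁ (ka≤z , ℤ.<-trans z<z+1 z+1<)
  where
  z<z+1 : z < z + 1ℤ
  z<z+1 = ℤ.suc[i]≤j⇒i<j (ℤ.≤-reflexive (ℤ.+-comm 1ℤ z))
... | no  _    | yes z<  = inj₂ (ℤ.≤-trans kb≤z-1 z-1≤z , z<)
  where
  z-1≤z : z + -1ℤ ≤ z
  z-1≤z = ℤ.i≤j⇒i-k≤j 1ℤ ℤ.≤-refl
... | no  ka≰z | no  z≮ = contradiction
  (ℕ.m*n≡1⇒m≡1 k ∣ d ∣ (trans (sym (ℤ.abs-* (+ k) d)) (cong ∣_∣ kd≡1)))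
  (λ k≡1 → ℕ.<-irrefl (sym k≡1) 2≤k)
  where
  d = a - b - 1ℤ
  ka≡z+1 : + k * a ≡ z + 1ℤ
  ka≡z+1 = ℤ.≤-antisym ka≤z+1 (subst (_≤ + k * a) (ℤ.+-comm 1ℤ z) (ℤ.i<j⇒suc[i]≤j (ℤ.≰⇒> ka≰z)))
  kb+k≡z : + k * b + + k ≡ z
  kb+k≡z = ℤ.≤-antisym (ℤ.≮⇒≥ z≮)
    (subst (_≤ + k * b + + k) (lemma z) (ℤ.i<j⇒suc[i]≤j z-1<))
    where
    lemma : ∀ z → 1ℤ + (z + -1ℤ) ≡ z
    lemma = solve-∀
  kd≡1 : + k * d ≡ 1ℤ
  kd≡1 = trans (expand (+ k) a b) (trans (cong₂ _-_ ka≡z+1 kb+k≡z) (cancel z))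
    where
    expand : ∀ k a b → k * (a - b - 1ℤ) ≡ k * a - (k * b + k)
    expand = solve-∀
    cancel : ∀ z → z + 1ℤ - z ≡ 1ℤ
    cancel = solve-∀

scale-gapless : ∀ k → 2 ℕ.≤ k → ∀ P → Gapless (scale k P)
scale-gapless k 2≤k P (x , y) = λ
  { (here refl)                         → λ r l → horizontal r l
  ; (there (here refl))                 → λ l r → horizontal r l
  ; (there (there (here refl)))         → λ u d → vertical u d
  ; (there (there (there (here refl)))) → λ d u → vertical u d }
  where
  horizontal : scale k P (x + 1ℤ , y + + 0) → scale k P (x + -1ℤ , y + + 0) → scale k P (x , y)
  horizontal (a , b , ab∈ , inx , iny) (a′ , b′ , ab∈′ , inx′ , iny′)
    with between k 2≤k a a′ x inx inx′
  ... | inj₁ inx = a , b , ab∈ , inx , subst (InBlock k b) (ℤ.+-identityʳ y) iny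
  ... | inj₂ inx = a′ , b′ , ab∈′ , inx , subst (InBlock k b′) (ℤ.+-identityʳ y) iny′
  vertical : scale k P (x + + 0 , y + 1ℤ) → scale k P (x + + 0 , y + -1ℤ) → scale k P (x , y)
  vertical (a , b , ab∈ , inx , iny) (a′ , b′ , ab∈′ , inx′ , iny′)
    with between k 2≤k b b′ y iny iny′
  ... | inj₁ iny = a , b , ab∈ , subst (InBlock k a) (ℤ.+-identityʳ x) inx , iny
  ... | inj₂ iny = a′ , b′ , ab∈′ , subst (InBlock k a′) (ℤ.+-identityʳ x) inx′ , iny

-- From integer to natural coordinates

emb : Cellℕ → Cell
emb (x , y) = (+ x , + y)

emb-injective : ∀ {c d} → emb c ≡ emb d → c ≡ d
emb-injective eq = cong₂ _,_ (ℤ.+-injective (cong proj₁ eq)) (ℤ.+-injective (cong proj₂ eq))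

⟦_⟧ : List Cellℕ → Region
⟦ L ⟧ c = ∃[ d ] d ∈ L × emb d ≡ c

⟦⟧-emb⁻ : ∀ {L c} → ⟦ L ⟧ (emb c) → c ∈ L
⟦⟧-emb⁻ {L} (d , d∈ , eq) = subst (_∈ L) (emb-injective eq) d∈

block-quot : ∀ k .{{_ : NonZero k}} a {z} → InBlock k (+ a) z → ∃[ x ] z ≡ + x × quot x k ≡ a
block-quot k a { -[1+ n ]} (ka≤z , _) =
  contradiction (subst (_≤ -[1+ n ]) (sym (ℤ.pos-* k a)) ka≤z) λ ()
block-quot k@(suc _) a {+ x} (ka≤z , z<) = x , refl , (begin
  x / k                    ≡⟨ cong (_/ k) (ℕ.m+[n∸m]≡n ka≤x) ⟨
  (k ℕ.* a ℕ.+ r) / k      ≡⟨ +-distrib-/-∣ˡ {k ℕ.* a} r (m∣m*n a) ⟩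
  k ℕ.* a / k ℕ.+ r / k    ≡⟨ cong₂ ℕ._+_ (trans (cong (_/ k) (ℕ.*-comm k a)) (m*n/n≡m a k)) (m<n⇒m/n≡0 r<k) ⟩
  a ℕ.+ 0                  ≡⟨ ℕ.+-identityʳ a ⟩
  a                        ∎)
  where
  open ≡-Reasoning
  r = x ℕ.∸ k ℕ.* a
  ka≤x : k ℕ.* a ℕ.≤ x
  ka≤x = ℤ.drop‿+≤+ (subst (_≤ + x) (sym (ℤ.pos-* k a)) ka≤z)
  x<ka+k : x ℕ.< k ℕ.* a ℕ.+ k
  x<ka+k = ℤ.drop‿+<+ (subst (λ n → + x < n + + k) (sym (ℤ.pos-* k a)) z<)
  r<k : r ℕ.< k
  r<k = ℕ.+-cancelˡ-< (k ℕ.* a) r k (subst (ℕ._< k ℕ.* a ℕ.+ k) (sym (ℕ.m+[n∸m]≡n ka≤x)) x<ka+k)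

quot-block : ∀ k .{{_ : NonZero k}} x → InBlock k (+ quot x k) (+ x)
quot-block k@(suc _) x =
  subst (λ n → n ≤ + x × + x < n + + k) (ℤ.pos-* k (x / k))
    (+≤+ (subst (k ℕ.* (x / k) ℕ.≤_) (sym split) (ℕ.m≤m+n _ _)) ,
     +<+ (subst (ℕ._< k ℕ.* (x / k) ℕ.+ k) (sym split) (ℕ.+-monoʳ-< (k ℕ.* (x / k)) (m%n<n x k))))
  where
  split : x ≡ k ℕ.* (x / k) ℕ.+ x % k
  split = trans (m≡m%n+[m/n]*n x k)
    (trans (ℕ.+-comm (x % k) _) (cong (ℕ._+ x % k) (ℕ.*-comm (x / k) k)))

J⇒isJ : ∀ {c} → J c → ∃[ d ] T (isJ d) × emb d ≡ c
J⇒isJ (here refl)                                 = (0 , 0) , _ , refl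
J⇒isJ (there (here refl))                         = (0 , 1) , _ , refl
J⇒isJ (there (there (here refl)))                 = (0 , 2) , _ , refl
J⇒isJ (there (there (there (here refl))))         = (1 , 0) , _ , refl
J⇒isJ (there (there (there (there (here refl))))) = (2 , 0) , _ , refl
J⇒isJ (there (there (there (there (there (here refl)))))) = (2 , 1) , _ , refl

isJ⇒J : ∀ a b → T (isJ (a , b)) → J (+ a , + b)
isJ⇒J 0 0 _ = here refl
isJ⇒J 0 1 _ = there (here refl)
isJ⇒J 0 2 _ = there (there (here refl))
isJ⇒J 1 0 _ = there (there (there (here refl)))
isJ⇒J 2 0 _ = there (there (there (there (here refl))))
isJ⇒J 2 1 _ = there (there (there (there (there (here refl)))))

scale-region : ∀ k .{{_ : NonZero k}} → scale k J ≐ ⟦ region k ⟧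
scale-region k = to , from
  where
  to : ∀ {c} → scale k J c → ⟦ region k ⟧ c
  to (_ , _ , ab∈ , inx , iny)
    with (a , b) , isJ-ab , refl ← J⇒isJ ab∈
    with x , refl , refl ← block-quot k a inx
    with y , refl , refl ← block-quot k b iny = (x , y) , ∈-region⁺ k isJ-ab , refl
  from : ∀ {c} → ⟦ region k ⟧ c → scale k J c
  from ((x , y) , c∈ , refl) = + quot x k , + quot y k ,
    isJ⇒J (quot x k) (quot y k) (proj₁ (∈-region⁻ k c∈)) , quot-block k x , quot-block k y

-- The outline of a matched pair

pair-cells : Kind → List Cell
pair-cells K = J-cells ++ partner-cells K

⋃-pair : ∀ K → ⋃ (Fin 2) (pair K) ≐ cells (pair-cells K)
⋃-pair K = to , from
  where
  to : ∀ {c} → ⋃ (Fin 2) (pair K) c → c ∈ pair-cells K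
  to (zero , c∈)     = ∈-++⁺ˡ (proj₁ (pair-zero K) c∈)
  to (suc zero , c∈) = ∈-++⁺ʳ J-cells (proj₁ (pair-suc K) c∈)
  from : ∀ {c} → c ∈ pair-cells K → ⋃ (Fin 2) (pair K) c
  from c∈ with ∈-++⁻ J-cells c∈
  ... | inj₁ c∈ = zero , proj₂ (pair-zero K) c∈
  ... | inj₂ c∈ = suc zero , proj₂ (pair-suc K) c∈

placeℤ : Shape → Cell → List Cell
placeℤ s o = map (λ d → o ⊕ emb d) (cellsOf s)

isCross : Kind → Bool
isCross rec   = false
isCross cross = true

Outlines : Kind → (Cell → Cell) → Shape × Cell → Set
Outlines K f (s , o) = notRectangle s (0 , 0) ≡ isCross K ×
  All (λ d → f d ∈ placeℤ s o) (pair-cells K) ×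
  All (λ c → c ∈ map f (pair-cells K)) (placeℤ s o)

outlines? : ∀ K f so → Dec (Outlines K f so)
outlines? K f (s , o) = (notRectangle s (0 , 0) Bool.≟ isCross K) ×-dec
  all? (λ d → f d ∈? placeℤ s o) (pair-cells K) ×-dec
  all? (λ c → c ∈? map f (pair-cells K)) (placeℤ s o)

outlines : ∀ K g → ∃[ so ] Outlines K (linear g) so
outlines K g = Any.satisfied (∀-bools (checked K) (transpose g) (flipX g) (flipY g))
  where
  open Isometry using (transpose; flipX; flipY)
  corners′ : List (Shape × Cell)
  corners′ = cartesianProduct shapes (cartesianProduct range range)
    -- The lower left corners of the bounding boxes of all eight images of both figures have
    -- coordinates from -3 to 0.
    where range = + 0 ∷ -1ℤ ∷ -[1+ 1 ] ∷ -[1+ 2 ] ∷ []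
  checked : ∀ K → All (λ t → All (λ a → All (λ b →
    Any (Outlines K (linear (isometry t a b (+ 0 , + 0)))) corners′) bools) bools) bools
  checked rec = from-yes (all? (λ t → all? (λ a → all? (λ b →
    any? (outlines? rec (linear (isometry t a b (+ 0 , + 0)))) corners′) bools) bools) bools)
  checked cross = from-yes (all? (λ t → all? (λ a → all? (λ b →
    any? (outlines? cross (linear (isometry t a b (+ 0 , + 0)))) corners′) bools) bools) bools)

⊕-swap : ∀ a b c → a ⊕ b ⊕ c ≡ a ⊕ c ⊕ b
⊕-swap (a , a′) (b , b′) (c , c′) = cong₂ _,_ (lemma a b c) (lemma a′ b′ c′)
  where
  lemma : ∀ a b c → a + b + c ≡ a + c + b
  lemma = solve-∀

outline : ∀ K g → ∃[ s ] ∃[ o ] notRectangle s (0 , 0) ≡ isCross K ×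
  image g (⋃ (Fin 2) (pair K)) ≐ cells (placeℤ s o)
outline K g with (s , o) , eq , into , onto ← outlines K g = s , o ⊕ shift g , eq , to , from
  where
  to : ∀ {c} → image g (⋃ (Fin 2) (pair K)) c → c ∈ placeℤ s (o ⊕ shift g)
  to (d , d∈ , refl)
    with e , e∈ , eq ← ∈-map⁻ (λ e → o ⊕ emb e) (All.lookup into (proj₁ (⋃-pair K) d∈)) =
    subst (_∈ placeℤ s (o ⊕ shift g))
      (trans (⊕-swap o (shift g) (emb e)) (cong (_⊕ shift g) (sym eq)))
      (∈-map⁺ (λ e → o ⊕ shift g ⊕ emb e) e∈)
  from : ∀ {c} → c ∈ placeℤ s (o ⊕ shift g) → image g (⋃ (Fin 2) (pair K)) c
  from c∈ with e , e∈ , refl ← ∈-map⁻ (λ e → o ⊕ shift g ⊕ emb e) c∈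
    with d , d∈ , eq ← ∈-map⁻ (linear g) {xs = pair-cells K} (All.lookup onto (∈-map⁺ (λ e → o ⊕ emb e) e∈)) =
    d , proj₂ (⋃-pair K) d∈ , trans (cong (_⊕ shift g) (sym eq)) (⊕-swap o (emb e) (shift g))

leftmost : ∀ s → Any (λ d → proj₁ d ≡ 0) (cellsOf s) × Any (λ d → proj₂ d ≡ 0) (cellsOf s)
leftmost s = All.lookup (from-yes (all? (λ s →
  any? (λ d → proj₁ d ℕ.≟ 0) (cellsOf s) ×-dec any? (λ d → proj₂ d ℕ.≟ 0) (cellsOf s)) shapes)) (∈-shapes s)

-- `X₁` and `X₃` miss the corner of their bounding box, so the two coordinates of `o` are read off
-- two cells, one in the first column and one in the first row.
natural : ∀ s o → (∀ {c} → c ∈ placeℤ s o → ∃[ d ] emb d ≡ c) → ∃[ a ] emb a ≡ o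
natural s (x , y) nonneg
  with (_ , v) , d∈ , refl ← find (proj₁ (leftmost s))
  with (u , _) , e∈ , refl ← find (proj₂ (leftmost s))
  with (x′ , _) , eq₁ ← nonneg (∈-map⁺ (λ d → (x , y) ⊕ emb d) d∈)
  with (_ , y′) , eq₂ ← nonneg (∈-map⁺ (λ d → (x , y) ⊕ emb d) e∈) =
  (x′ , y′) , cong₂ _,_ (trans (cong proj₁ eq₁) (ℤ.+-identityʳ x)) (trans (cong proj₂ eq₂) (ℤ.+-identityʳ y))

placeℤ-emb : ∀ s a → cells (placeℤ s (emb a)) ≐ ⟦ place s a ⟧
placeℤ-emb s a =
  (λ c∈ → let d , d∈ , eq = ∈-map⁻ (λ d → emb a ⊕ emb d) c∈ in a ⊹ d , ∈-map⁺ (a ⊹_) d∈ , sym eq) ,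
  from
  where
  from : ∀ {c} → ⟦ place s a ⟧ c → c ∈ placeℤ s (emb a)
  from (_ , c∈ , refl) with d , d∈ , refl ← ∈-map⁻ (a ⊹_) c∈ = ∈-map⁺ (λ d → emb a ⊕ emb d) d∈

outlineℕ : ∀ k .{{_ : NonZero k}} K g →
  (∀ {c} → image g (⋃ (Fin 2) (pair K)) c → scale k J c) →
  ∃[ s ] ∃[ a ] notRectangle s (0 , 0) ≡ isCross K ×
  image g (⋃ (Fin 2) (pair K)) ≐ ⟦ place s a ⟧
outlineℕ k K g inside with s , o , eq , to , from ← outline K g
  with a , refl ← natural s o (λ c∈ → let d , _ , eq = proj₁ (scale-region k) (inside (from c∈)) in d , eq) =
  s , a , eq , (λ c∈ → proj₁ (placeℤ-emb s a) (to c∈)) , (λ c∈ → from (proj₂ (placeℤ-emb s a) c∈))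

tiling : ∀ k .{{_ : NonZero k}} {m} (shape : Fin m → Shape) (anchor : Fin m → Cellℕ) {q : Fin m → Region} →
  (∀ a → q a ≐ ⟦ place (shape a) (anchor a) ⟧) → Dissects (scale k J) q → Tiling (region k)
tiling k {m} shape anchor {q} q≐ dissects@((covered , inner) , _) = record
  { size   = m
  ; shape  = shape
  ; anchor = anchor
  ; covers = λ {c} c∈ → let a , qc = covered (proj₂ (scale-region k) (c , c∈ , refl))
                        in a , ⟦⟧-emb⁻ (proj₁ (q≐ a) qc)
  ; inside = λ a {c} c∈ → ⟦⟧-emb⁻ (proj₁ (scale-region k) (inner (a , proj₂ (q≐ a) (c , c∈ , refl))))
  ; apart  = λ {a} {b} {c} c∈a c∈b → same-index dissects (proj₂ (q≐ a) (c , c∈a , refl)) (proj₂ (q≐ b) (c , c∈b , refl))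
  }

-- The tiling of kJ by the outlines of the pairs

module _ {n : ℕ} {p : Fin n → Region} (P : Pairing p) where
  open Pairing P

  block : Fin size → Region
  block a = image (motion a) (⋃ (Fin 2) (pair (kind a)))

  block⇒piece : ∀ a {c} → block a c → ∃[ b ] p (from (a , b)) c
  block⇒piece a (d , (b , d∈) , eq) = b , proj₂ (pieces a b) (d , d∈ , eq)

  piece⇒block : ∀ i {c} → p i c → block (proj₁ (to i)) c
  piece⇒block i pi
    with d , d∈ , eq ← proj₁ (pieces (proj₁ (to i)) (proj₂ (to i))) (subst (λ j → p j _) (sym (strictlyInverseʳ i)) pi)
    = d , (proj₂ (to i) , d∈) , eq

  blocks-dissect : ∀ {R} → Dissects R p → Dissects R block
  blocks-dissect ((covered , inner) , apart) =
    ( (λ c∈ → let i , pi = covered c∈ in proj₁ (to i) , piece⇒block i pi)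
    , (λ (a , c∈) → let b , pi = block⇒piece a c∈ in inner (from (a , b) , pi)) ) ,
    λ {a} {a′} a≢a′ (c∈ , c∈′) →
      let b , pi = block⇒piece a c∈ ; b′ , pi′ = block⇒piece a′ c∈′ in
      apart (λ eq → a≢a′ (cong proj₁ (trans (sym (strictlyInverseˡ (a , b)))
                                        (trans (cong to eq) (strictlyInverseˡ (a′ , b′)))))) (pi , pi′)

record Layout (k : ℕ) {p : Fin (k ℕ.^ 2) → Region} (P : Pairing p) : Set₁ where
  open Pairing P using (size; kind)
  field
    dissected   : Dissects (scale k J) (block P)
    shape       : Fin size → Shape
    anchor      : Fin size → Cellℕ
    shape-kind  : ∀ a → notRectangle (shape a) (0 , 0) ≡ isCross (kind a)
    block-place : ∀ a → block P a ≐ ⟦ place (shape a) (anchor a) ⟧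

  tiled : .{{_ : NonZero k}} → Tiling (region k)
  tiled = tiling k shape anchor block-place dissected

layout : ∀ k .{{_ : NonZero k}} {p : Fin (k ℕ.^ 2) → Region} (P : Pairing p) →
         Dissects (scale k J) (block P) → Layout k P
layout k P dissected = record
  { dissected   = dissected
  ; shape       = λ a → proj₁ (outlined a)
  ; anchor      = λ a → proj₁ (proj₂ (outlined a))
  ; shape-kind  = λ a → proj₁ (proj₂ (proj₂ (outlined a)))
  ; block-place = λ a → proj₂ (proj₂ (proj₂ (outlined a)))
  }
  where
  open Pairing P
  outlined : ∀ a → ∃[ s ] ∃[ o ] notRectangle s (0 , 0) ≡ isCross (kind a) × block P a ≐ ⟦ place s o ⟧
  outlined a = outlineℕ k (kind a) (motion a) (λ c∈ → proj₂ (proj₁ dissected) (a , c∈))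

solved : ∀ k .{{_ : NonZero k}} → 2 ℕ.≤ k → {p : Fin (k ℕ.^ 2) → Region} → IsSolution J k p →
         Σ[ P ∈ Pairing p ] Layout k P
solved k 2≤k {p} (congruent , dissects) = extend (pairing (scale-gapless k 2≤k J) congruent dissects)
  where
  extend : Pairing p → Σ[ P ∈ Pairing p ] Layout k P
  extend P = P , layout k P (blocks-dissect P dissects)

-- The values of k without a solution

odd⇒¬rep : ∀ k → ¬ (2 ∣ k) → k ≢ 1 → ¬ IsRepTile-rep[ k ^2] J
odd⇒¬rep zero            odd k≢1 _              = odd (2 ∣0)
odd⇒¬rep (suc zero)      odd k≢1 _              = k≢1 refl
odd⇒¬rep k@(suc (suc _)) odd k≢1 (p , solution) = odd
  ([ id , id ]′ (euclidsLemma k k prime[2] (even (proj₁ (solved k (s≤s (s≤s z≤n)) solution)))))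
  where
  even : Pairing p → 2 ∣ k ℕ.* k
  -- `k ^ 2` unfolds to `k * (k * 1)`.
  even P = divides (Pairing.size P) (trans (cong (k ℕ.*_) (sym (ℕ.*-identityʳ k))) (Pairing.even P))

unbalanced⇒¬rep : ∀ k .{{_ : NonZero k}} → 2 ℕ.≤ k → count 0 (region k) ≢ count 1 (region k) →
                  ¬ IsRepTile-rep[ k ^2] J
unbalanced⇒¬rep k 2≤k ≢ (p , solution) =
  ≢ (region-balanced (region-unique k) (Layout.tiled (proj₂ (solved k 2≤k solution))))

small⇒¬rep : All (λ k → ¬ IsRepTile-rep[ k ^2] J) (2 ∷ 4 ∷ 8 ∷ 10 ∷ 14 ∷ 16 ∷ 20 ∷ 22 ∷ [])
small⇒¬rep = All.zipWith (λ {k} (2≤k , ≢) → unbalanced⇒¬rep k {{>-nonZero (ℕ.≤-trans (s≤s z≤n) 2≤k)}} 2≤k ≢)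
  (from-yes (all? (2 ℕ.≤?_) (2 ∷ 4 ∷ 8 ∷ 10 ∷ 14 ∷ 16 ∷ 20 ∷ 22 ∷ [])) , unbalanced)

-- Rectangles divided by J-rec, and the solutions for k = 12

place-rectangle : ∀ o w h → ⟦ map (o ⊹_) (box w h) ⟧ ≐ rectangle (emb o) w h
place-rectangle o@(x , y) w h = to , from
  where
  to : ∀ {c} → ⟦ map (o ⊹_) (box w h) ⟧ c → rectangle (emb o) w h c
  to (_ , d∈ , refl) with (i , j) , ij∈ , refl ← ∈-map⁻ (o ⊹_) d∈
    with i∈ , j∈ ← ∈-cartesianProduct⁻ (upTo w) (upTo h) ij∈ =
    (+≤+ (ℕ.m≤m+n x i) , +<+ (ℕ.+-monoʳ-< x (∈-upTo⁻ i∈))) ,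
    (+≤+ (ℕ.m≤m+n y j) , +<+ (ℕ.+-monoʳ-< y (∈-upTo⁻ j∈)))
  offset : ∀ x w {z} → + x ≤ z → z < + x + + w → ∃[ i ] i ℕ.< w × + (x ℕ.+ i) ≡ z
  offset x w {+ z} (+≤+ x≤z) (+<+ z<) =
    z ℕ.∸ x , ℕ.+-cancelˡ-< x _ w (subst (ℕ._< x ℕ.+ w) (sym (ℕ.m+[n∸m]≡n x≤z)) z<) ,
    cong +_ (ℕ.m+[n∸m]≡n x≤z)
  from : ∀ {c} → rectangle (emb o) w h c → ⟦ map (o ⊹_) (box w h) ⟧ c
  from ((x≤ , x<) , (y≤ , y<)) with i , i< , refl ← offset x w x≤ x< | j , j< , refl ← offset y h y≤ y< =
    _ , ∈-map⁺ (o ⊹_) (∈-cartesianProduct⁺ (∈-upTo⁺ i<) (∈-upTo⁺ j<)) , refl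

isRectangle : ∀ {R} s o → notRectangle s (0 , 0) ≡ false → R ≐ ⟦ place s o ⟧ → Is3×4Rectangle R
isRectangle V o _ R≐ = emb o , inj₁ (≐-trans R≐ (place-rectangle o 3 4))
isRectangle H o _ R≐ = emb o , inj₂ (≐-trans R≐ (place-rectangle o 4 3))

divided : ∀ {n} {p : Fin n → Region} (P : Pairing p) → (∀ a → Pairing.kind P a ≡ rec) →
          DividedByJ-rec (block P) p
divided {p = p} P isRec = motion ,
  (λ a → subst (λ K → image (motion a) (⋃ (Fin 2) J-rec) ≐ image (motion a) (⋃ (Fin 2) (pair K))) (sym (isRec a)) ≐-refl) ,
  matched , same
  where
  open Pairing P
  same : ∀ i → p i ≐ image (motion (proj₁ (to i))) (J-rec (proj₂ (to i)))
  same i = subst (λ K → p i ≐ image (motion (proj₁ (to i))) (pair K (proj₂ (to i)))) (isRec (proj₁ (to i)))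
    (subst (λ j → p j ≐ image (motion (proj₁ (to i))) (pair (kind (proj₁ (to i))) (proj₂ (to i)))) (strictlyInverseʳ i)
      (pieces (proj₁ (to i)) (proj₂ (to i))))

-- Replaces the numbering of the blocks that comes from the pairing by the columns and rows used in
-- the case k = 6.
reindex : ∀ {A B I : Set} {k} {q : A → Region} {r : B → Region} {p : I → Region}
  (f : A → B) (g : B → A) → (∀ b → f (g b) ≡ b) → (∀ a → g (f a) ≡ a) →
  (∀ a → q a ≐ r (f a)) → ObtainedFrom k q p → ObtainedFrom k r p
reindex {q = q} {r} {p} f g fg gf q≐ (((covered , inner) , apart) , motion , motion≐ , matched , same) =
  (((λ c∈ → let a , qa = covered c∈ in f a , proj₁ (q≐ a) qa) , λ (b , rb) → inner (g b , proj₂ (r≐ b) rb)) ,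
   λ {b} {b′} b≢b′ (rb , rb′) → apart (λ eq → b≢b′ (trans (sym (fg b)) (trans (cong f eq) (fg b′))))
     (proj₂ (r≐ b) rb , proj₂ (r≐ b′) rb′)) ,
  motion ∘ g , (λ b → ≐-trans (motion≐ (g b)) (r≐ b)) ,
  mk↔ₛ′ (λ i → f (proj₁ (to i)) , proj₂ (to i)) (λ (b , c) → from (g b , c))
    (λ (b , c) → trans (cong (λ (a , c) → f a , c) (strictlyInverseˡ (g b , c))) (cong (_, c) (fg b)))
    (λ i → trans (cong (λ a → from (a , proj₂ (to i))) (gf (proj₁ (to i)))) (strictlyInverseʳ i)) ,
  λ i → subst (λ a → p i ≐ image (motion a) (J-rec (proj₂ (to i)))) (sym (gf (proj₁ (to i)))) (same i)
  where
  open Inverse matched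
  r≐ : ∀ b → q (g b) ≐ r b
  r≐ b = subst (λ b′ → q (g b) ≐ r b′) (fg b) (q≐ (g b))

-- The half turn about the centre of the figure, which exchanges its two pieces.
turned : Kind → Isometry
turned rec   = isometry false true true (+ 3 , + 2)
turned cross = isometry false true true (+ 1 , + 3)

turned-partner : ∀ K → image (turned K) J ≐ pair K (suc zero)
turned-partner K =
  (λ { (d , d∈ , refl) → proj₂ (pair-suc K) (All.lookup (into K) d∈) }) ,
  (λ c∈ → let d , d∈ , eq = ∈-map⁻ (act (turned K)) {xs = J-cells} (All.lookup (onto K) (proj₁ (pair-suc K) c∈))
          in d , d∈ , sym eq)
  where
  into : ∀ K → All (λ d → act (turned K) d ∈ partner-cells K) J-cells
  into rec   = from-yes (all? (λ d → act (turned rec) d ∈? partner-cells rec) J-cells)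
  into cross = from-yes (all? (λ d → act (turned cross) d ∈? partner-cells cross) J-cells)
  onto : ∀ K → All (λ c → c ∈ map (act (turned K)) J-cells) (partner-cells K)
  onto rec   = from-yes (all? (λ c → c ∈? map (act (turned rec)) J-cells) (partner-cells rec))
  onto cross = from-yes (all? (λ c → c ∈? map (act (turned cross)) J-cells) (partner-cells cross))

-- No equality test on the index set of the rectangles is needed: the pieces
-- are disjoint as soon as it is impossible that their rectangles differ.
obtained⇒solution : ∀ {I : Set} k {rect : I → Region} {p : Fin (k ℕ.^ 2) → Region} →
                    ObtainedFrom k rect p → IsSolution J k p
obtained⇒solution k {rect} {p} (((covered , inner) , apart) , motion , motion≐ , matched , same) =
  congruent , (covering , inside) , disjoint
  where
  open Inverse matched
  J-rec-congruent : ∀ b → Congruent J (J-rec b)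
  J-rec-congruent zero       = isometry false false false (+ 0 , + 0) ,
    (λ { (c , c∈ , refl) → subst J (zero-shift c) c∈ }) , (λ {c} c∈ → c , c∈ , sym (zero-shift c))
    where
    zero-shift : ∀ c → c ≡ act (isometry false false false (+ 0 , + 0)) c
    zero-shift (x , y) = cong₂ _,_ (sym (ℤ.+-identityʳ x)) (sym (ℤ.+-identityʳ y))
  J-rec-congruent (suc zero) = turned rec , turned-partner rec
  congruent : ∀ i → Congruent J (p i)
  congruent i with h , h≐ ← J-rec-congruent (proj₂ (to i)) = motion (proj₁ (to i)) ∙ h ,
    ≐-trans (image-∙ (motion (proj₁ (to i))) h J) (≐-trans (image-cong (motion (proj₁ (to i))) h≐) (≐-sym (same i)))
  in-rect : ∀ i {c} → p i c → rect (proj₁ (to i)) c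
  in-rect i pi = let d , d∈ , eq = proj₁ (same i) pi in proj₁ (motion≐ (proj₁ (to i))) (d , (proj₂ (to i) , d∈) , eq)
  covering : ∀ {c} → scale k J c → ⋃ _ p c
  covering c∈ = let a , c∈a = covered c∈ ; d , (b , d∈) , eq = proj₂ (motion≐ a) c∈a in
    from (a , b) , proj₂ (same (from (a , b)))
      (subst (λ (a , b) → image (motion a) (J-rec b) _) (sym (strictlyInverseˡ (a , b))) (d , d∈ , eq))
  inside : ∀ {c} → ⋃ _ p c → scale k J c
  inside (i , pi) = inner (proj₁ (to i) , in-rect i pi)
  J-rec-disjoint : ∀ b b′ → b ≢ b′ → ∀ {c} → J-rec b c → J-rec b′ c → ⊥
  J-rec-disjoint zero       zero       ≢ _ _   = ≢ refl
  J-rec-disjoint (suc zero) (suc zero) ≢ _ _   = ≢ refl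
  J-rec-disjoint zero       (suc zero) _ c∈ c∈′ = All.lookup separate c∈ c∈′
    where
    separate : All (λ c → c ∉ partner-cells rec) J-cells
    separate = from-yes (all? (_∉? partner-cells rec) J-cells)
  J-rec-disjoint (suc zero) zero       ≢ c∈ c∈′ = J-rec-disjoint zero (suc zero) (λ ()) c∈′ c∈
  disjoint : ∀ {i j} → i ≢ j → ∀ {c} → p i c × p j c → ⊥
  disjoint {i} {j} i≢j {c} (pi , pj) = apart different (in-rect i pi , in-rect j pj)
    where
    overlapping : ∀ a b a′ b′ → image (motion a) (J-rec b) c → image (motion a′) (J-rec b′) c → a ≡ a′ → b ≢ b′ → ⊥
    overlapping a b _ b′ (d , d∈ , eq) (d′ , d′∈ , eq′) refl b≢b′ =
      J-rec-disjoint b b′ b≢b′ (subst (J-rec b) (act-injective (motion a) (trans eq (sym eq′))) d∈) d′∈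
    different : proj₁ (to i) ≢ proj₁ (to j)
    different a≡a′ = overlapping _ _ _ _ (proj₁ (same i) pi) (proj₁ (same j) pj) a≡a′
      (λ b≡b′ → i≢j (trans (sym (strictlyInverseʳ i)) (trans (cong from (cong₂ _,_ a≡a′ b≡b′)) (strictlyInverseʳ j))))

notRectangle-irrelevant : ∀ s c d → notRectangle s c ≡ notRectangle s d
notRectangle-irrelevant V  _ _ = refl
notRectangle-irrelevant H  _ _ = refl
notRectangle-irrelevant X₁ _ _ = refl
notRectangle-irrelevant X₂ _ _ = refl
notRectangle-irrelevant X₃ _ _ = refl
notRectangle-irrelevant X₄ _ _ = refl

isCross≡false : ∀ K → isCross K ≡ false → K ≡ rec
isCross≡false rec _ = refl

DissectedBy72 : (Fin (12 ℕ.^ 2) → Region) → Set₁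
DissectedBy72 p = ∃[ rect ] ((∀ (i : Fin 72) → Is3×4Rectangle (rect i)) × ObtainedFrom 12 rect p)

solution-12J : (p : Fin (12 ℕ.^ 2) → Region) → IsSolution J 12 p ⇔ DissectedBy72 p
solution-12J p = mk⇔
  (λ solution → let P , L = solved 12 (s≤s (s≤s z≤n)) solution in forward P L)
  (λ (rect , _ , obtained) → obtained⇒solution 12 obtained)
  where
  relabel : ∀ {m} → m ≡ 72 → (rect : Fin m → Region) → (∀ i → Is3×4Rectangle (rect i)) →
            ObtainedFrom 12 rect p → DissectedBy72 p
  relabel refl rect rects obtained = rect , rects , obtained
  forward : (P : Pairing p) → Layout 12 P → DissectedBy72 p
  -- The pairing gives `144 ≡ size * 2`.
  forward P L = relabel (ℕ.*-cancelʳ-≡ size 72 2 (sym even)) (block P)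
    (λ a → isRectangle (shape a) (anchor a) (straight a) (block-place a))
    (dissected , divided P (λ a → isCross≡false (kind a) (trans (sym (shape-kind a)) (straight a))))
    where
    open Pairing P using (size; even; kind)
    open Layout L
    straight : ∀ a → notRectangle (shape a) (0 , 0) ≡ false
    straight a = trans (notRectangle-irrelevant (shape a) (0 , 0) (anchor a ⊹ margin)) (no-X-in-12J tiled a)

-- The solutions for k = 6

Index : Set
Index = (Fin 2 × Fin 3) ⊎ (Fin 3 × Fin 2) ⊎ (Fin 2 × Fin 3)

corner : Index → Shape × Cellℕ
corner (inj₁ (i , j))        = V , (3 ℕ.* toℕ i , 6 ℕ.+ 4 ℕ.* toℕ j)
corner (inj₂ (inj₁ (i , j))) = H , (4 ℕ.* toℕ i , 3 ℕ.* toℕ j)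
corner (inj₂ (inj₂ (i , j))) = V , (12 ℕ.+ 3 ℕ.* toℕ i , 4 ℕ.* toℕ j)

indices : List Index
indices = map inj₁ (cartesianProduct (allFin 2) (allFin 3))
       ++ map (inj₂ ∘ inj₁) (cartesianProduct (allFin 3) (allFin 2))
       ++ map (inj₂ ∘ inj₂) (cartesianProduct (allFin 2) (allFin 3))

∈-indices : ∀ r → r ∈ indices
∈-indices (inj₁ (i , j)) = ∈-++⁺ˡ (∈-map⁺ inj₁ (∈-cartesianProduct⁺ (∈-allFin i) (∈-allFin j)))
∈-indices (inj₂ (inj₁ (i , j))) = ∈-++⁺ʳ (map inj₁ (cartesianProduct (allFin 2) (allFin 3)))
  (∈-++⁺ˡ (∈-map⁺ (inj₂ ∘ inj₁) (∈-cartesianProduct⁺ (∈-allFin i) (∈-allFin j))))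
∈-indices (inj₂ (inj₂ (i , j))) = ∈-++⁺ʳ (map inj₁ (cartesianProduct (allFin 2) (allFin 3)))
  (∈-++⁺ʳ (map (inj₂ ∘ inj₁) (cartesianProduct (allFin 3) (allFin 2)))
    (∈-map⁺ (inj₂ ∘ inj₂) (∈-cartesianProduct⁺ (∈-allFin i) (∈-allFin j))))

rectangle-corner : ∀ r → rectanglesOf6J r ≐ ⟦ uncurry place (corner r) ⟧
rectangle-corner r@(inj₁ _)        = ≐-sym (place-rectangle (proj₂ (corner r)) 3 4)
rectangle-corner r@(inj₂ (inj₁ _)) = ≐-sym (place-rectangle (proj₂ (corner r)) 4 3)
rectangle-corner r@(inj₂ (inj₂ _)) = ≐-sym (place-rectangle (proj₂ (corner r)) 3 4)

rectanglesOf6J-corner : ∀ r → rectanglesOf6J r (emb (proj₂ (corner r)))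
rectanglesOf6J-corner r = proj₂ (rectangle-corner r) (_ , own r , refl)
  where
  own : ∀ r → proj₂ (corner r) ∈ uncurry place (corner r)
  own r = All.lookup (from-yes (all? (λ r → proj₂ (corner r) ∈ℕ? uncurry place (corner r)) indices)) (∈-indices r)

corner-in-6J : ∀ r → scale 6 J (emb (proj₂ (corner r)))
corner-in-6J r = proj₂ (scale-region 6) (_ , ∈-region⁺ 6
  (All.lookup (from-yes (all? (λ r → T? (inkJ 6 (proj₂ (corner r)))) indices)) (∈-indices r)) , refl)

corner-owner : ∀ r r′ → rectanglesOf6J r′ (emb (proj₂ (corner r))) → r ≡ r′
corner-owner r r′ c∈ = All.lookup (All.lookup separate (∈-indices r)) (∈-indices r′)
  (⟦⟧-emb⁻ (proj₁ (rectangle-corner r′) c∈))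
  where
  _≟ᵢ_ : DecidableEquality Index
  _≟ᵢ_ = Sum.≡-dec (Product.≡-dec Fin._≟_ Fin._≟_) (Sum.≡-dec (Product.≡-dec Fin._≟_ Fin._≟_) (Product.≡-dec Fin._≟_ Fin._≟_))
  separate : All (λ r → All (λ r′ → proj₂ (corner r) ∈ uncurry place (corner r′) → r ≡ r′) indices) indices
  separate = from-yes (all? (λ r → all? (λ r′ →
    (proj₂ (corner r) ∈ℕ? uncurry place (corner r′)) →-dec (r ≟ᵢ r′)) indices) indices)

find-corner : ∀ s {c} → c ∈ corners s → ∃[ r ] corner r ≡ (s , c)
find-corner V c∈ with ∈-++⁻ (map (λ (i , j) → (3 ℕ.* i , 6 ℕ.+ 4 ℕ.* j)) (box 2 3)) c∈
... | inj₁ c∈ with (i , j) , ij∈ , refl ← ∈-map⁻ (λ (i , j) → (3 ℕ.* i , 6 ℕ.+ 4 ℕ.* j)) {xs = box 2 3} c∈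
  with i∈ , j∈ ← ∈-cartesianProduct⁻ (upTo 2) (upTo 3) ij∈ =
  inj₁ (fromℕ< (∈-upTo⁻ i∈) , fromℕ< (∈-upTo⁻ j∈)) ,
  cong₂ (λ i j → V , (3 ℕ.* i , 6 ℕ.+ 4 ℕ.* j)) (Fin.toℕ-fromℕ< (∈-upTo⁻ i∈)) (Fin.toℕ-fromℕ< (∈-upTo⁻ j∈))
... | inj₂ c∈ with (i , j) , ij∈ , refl ← ∈-map⁻ (λ (i , j) → (12 ℕ.+ 3 ℕ.* i , 4 ℕ.* j)) {xs = box 2 3} c∈
  with i∈ , j∈ ← ∈-cartesianProduct⁻ (upTo 2) (upTo 3) ij∈ =
  inj₂ (inj₂ (fromℕ< (∈-upTo⁻ i∈) , fromℕ< (∈-upTo⁻ j∈))) ,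
  cong₂ (λ i j → V , (12 ℕ.+ 3 ℕ.* i , 4 ℕ.* j)) (Fin.toℕ-fromℕ< (∈-upTo⁻ i∈)) (Fin.toℕ-fromℕ< (∈-upTo⁻ j∈))
find-corner H c∈ with (i , j) , ij∈ , refl ← ∈-map⁻ (λ (i , j) → (4 ℕ.* i , 3 ℕ.* j)) {xs = box 3 2} c∈
  with i∈ , j∈ ← ∈-cartesianProduct⁻ (upTo 3) (upTo 2) ij∈ =
  inj₂ (inj₁ (fromℕ< (∈-upTo⁻ i∈) , fromℕ< (∈-upTo⁻ j∈))) ,
  cong₂ (λ i j → H , (4 ℕ.* i , 3 ℕ.* j)) (Fin.toℕ-fromℕ< (∈-upTo⁻ i∈)) (Fin.toℕ-fromℕ< (∈-upTo⁻ j∈))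

module _ {p : Fin (6 ℕ.^ 2) → Region} (P : Pairing p) (L : Layout 6 P) where
  open Pairing P using (size; kind)
  open Layout L

  -- The search sends every block to one of the 18 rectangles. The inverse map sends a rectangle to
  -- the block that owns its corner cell; since blocks are disjoint, and so are the rectangles, both
  -- round trips are the identity.
  obtained-6J : (∀ a → ∃[ r ] corner r ≡ (shape a , anchor a)) → ObtainedFrom 6 rectanglesOf6J p
  obtained-6J located = reindex index piece index-piece piece-index block≐
    (dissected , divided P (λ a → isCross≡false (kind a) (trans (sym (shape-kind a)) (straight (located a)))))
    where
    straight : ∀ {s c} → ∃[ r ] corner r ≡ (s , c) → notRectangle s (0 , 0) ≡ false
    straight (inj₁ _        , refl) = refl
    straight (inj₂ (inj₁ _) , refl) = refl
    straight (inj₂ (inj₂ _) , refl) = refl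
    index : Fin size → Index
    index a = proj₁ (located a)
    block≐ : ∀ a → block P a ≐ rectanglesOf6J (index a)
    block≐ a = ≐-trans (block-place a) (subst (λ r → ⟦ uncurry place r ⟧ ≐ rectanglesOf6J (index a))
      (proj₂ (located a)) (≐-sym (rectangle-corner (index a))))
    owner : ∀ r → ∃[ a ] block P a (emb (proj₂ (corner r)))
    owner r = proj₁ (proj₁ dissected) (corner-in-6J r)
    piece : Index → Fin size
    piece r = proj₁ (owner r)
    index-piece : ∀ r → index (piece r) ≡ r
    index-piece r = sym (corner-owner r (index (piece r)) (proj₁ (block≐ (piece r)) (proj₂ (owner r))))
    piece-index : ∀ a → piece (index a) ≡ a
    piece-index a = same-index dissected (proj₂ (owner (index a)))
      (proj₂ (block≐ a) (rectanglesOf6J-corner (index a)))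

solution-6J : (p : Fin (6 ℕ.^ 2) → Region) → IsSolution J 6 p ⇔ ObtainedFrom 6 rectanglesOf6J p
solution-6J p = mk⇔
  (λ solution → let P , L = solved 6 (s≤s (s≤s z≤n)) solution in forward P L)
  (obtained⇒solution 6)
  where
  forward : (P : Pairing p) → Layout 6 P → ObtainedFrom 6 rectanglesOf6J p
  forward P L = obtained-6J P L (λ a → find-corner (shape a) (corners-in-6J tiled a))
    where open Layout L

-- Solutions with both figures for k = 18 and k = 24

Motion : Set
Motion = Kind × Isometry

grid : (Cellℕ → Motion) → Cellℕ → Cellℕ → ℕ → ℕ → List Motion
grid tile o (w , h) m n = map (λ (i , j) → tile (o ⊹ (w ℕ.* i , h ℕ.* j))) (box m n)

-- `o` is always the lower left corner of the bounding box. `J-X` spans the columns -1 to 2 and its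
-- mirror image the columns -2 to 1, whence the shifts by 1 and 2.
upright lying crossing mirrored : Cellℕ → Motion
upright o  = rec , isometry true false false (emb o)
lying o    = rec , isometry false false false (emb o)
crossing o = cross , isometry false false false (emb (o ⊹ (1 , 0)))
mirrored o = cross , isometry false true false (emb (o ⊹ (2 , 0)))

-- Bands of heights 6, 4 and 6. The outer bands split the width as 4 + 3 + 4 + 4, and their columns
-- of width 3 hold a 3 × 4 rectangle and leave a 3 × 2 block. The middle band splits the width into
-- columns of width 3, and its second column consists of two 3 × 2 blocks. It lies one cell to the
-- left of the outer gaps, so each of its blocks joins the gap next to it to form an X-shape.
rectangle15×16 : Cellℕ → List Motion
rectangle15×16 o =
    grid lying o (7 , 3) 2 2 ++ grid lying (o ⊹ (11 , 0)) (0 , 3) 1 2 ++ upright (o ⊹ (4 , 0))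
  ∷ crossing (o ⊹ (3 , 4)) ∷ mirrored (o ⊹ (3 , 8))
  ∷ upright (o ⊹ (0 , 6)) ∷ grid upright (o ⊹ (6 , 6)) (3 , 4) 3 1
 ++ grid lying (o ⊹ (0 , 10)) (7 , 3) 2 2 ++ grid lying (o ⊹ (11 , 10)) (0 , 3) 1 2 ++ upright (o ⊹ (4 , 12)) ∷ []

-- Used with `m` = k / 3 and `n` = k / 2. The 15 × 16 rectangle takes the top left corner of the arm
-- of width k and height 2k and replaces five columns and four rows of 3 × 4 rectangles there; 15 ≤
-- k holds for both values.
motions : (k columns rows : ℕ) → List Motion
motions k m n =
     rectangle15×16 (0 , 3 ℕ.* k ℕ.∸ 16)
  ++ grid upright (15 , 3 ℕ.* k ℕ.∸ 16) (3 , 4) (m ℕ.∸ 5) 4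
  ++ grid upright (0 , k) (3 , 4) m (n ℕ.∸ 4)
  ++ grid lying (0 , 0) (4 , 3) n m
  ++ grid upright (2 ℕ.* k , 0) (3 , 4) m n

pieces : List Motion → List Isometry
pieces = concatMap (λ (K , g) → g ∷ g ∙ turned K ∷ [])

abs : Cell → Cellℕ
abs (x , y) = (∣ x ∣ , ∣ y ∣)

footprint : Isometry → List Cellℕ
footprint g = map (abs ∘ act g) J-cells

module Construction (k : ℕ) .{{_ : NonZero k}} (gs : List Isometry) where
  open Mask (3 ℕ.* k)

  -- `emb` undoes `abs` exactly on cells without negative coordinates, which is what the first test
  -- establishes.
  fitting : Isometry → Cell → Bool
  fitting g d = isYes (emb (abs (act g d)) ≟ act g d) ∧ inkJ k (abs (act g d))

  inside : Isometry → Bool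
  inside g = all (fitting g) J-cells

  distinct : ℕ → List Cellℕ → Bool
  distinct m []       = true
  distinct m (c ∷ cs) = not (has m c) ∧ distinct (m ℕ.+ pow c) cs

  complete : ℕ → Bool
  complete m = all (has m) (region k)

  check : Bool
  check = all inside gs ∧ distinct 0 (concatMap footprint gs) ∧ complete (fill 0 (concatMap footprint gs))

  -- Once `c` has been entered its digit is 1, so every later cell that is found free differs from
  -- `c` and was already free before.
  distinct-sound : ∀ {m cs} → InStrip cs → distinct m cs ≡ true → Free m cs × Unique cs
  distinct-sound {m} {cs = []} _ _ = [] , []
  distinct-sound {m} {c ∷ cs} (i ∷ is) ok with has m c in eq
  ... | false with free , unique ← distinct-sound is ok =
    eq ∷ All.zipWith (λ {d} (c≢d , i , f) → trans (sym (has-set-other m c d eq (All.head strip) i c≢d)) f)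
           (c∉ , All.zip (is , free)) ,
    c∉ ∷ unique
    where
    strip : InStrip (c ∷ cs)
    strip = i ∷ is
    c∉ : All (c ≢_) cs
    c∉ = All.map (λ f c≡d → contradiction (trans (sym (has-set-same m c eq))
      (trans (cong (has (m ℕ.+ pow c)) c≡d) f)) λ ()) free

  has-0 : ∀ c → has 0 c ≡ false
  has-0 c = cong odd (quot-0 (pow c))
    where
    quot-0 : ∀ d → quot 0 d ≡ 0
    quot-0 zero    = refl
    quot-0 (suc d) = 0/n≡0 (suc d)

unique-++ʳ : ∀ {A : Set} (xs : List A) {ys} → Unique (xs ++ ys) → Unique ys
unique-++ʳ []       u       = u
unique-++ʳ (x ∷ xs) (_ ∷ u) = unique-++ʳ xs u

unique-++ : ∀ {A : Set} (xs : List A) {ys} → Unique (xs ++ ys) → ∀ {c} → c ∈ xs → c ∉ ys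
unique-++ (x ∷ xs) (x∉ ∷ _) (here refl) c∈ = All.lookup x∉ (∈-++⁺ʳ xs c∈) refl
unique-++ (x ∷ xs) (_ ∷ u)  (there c∈)  c∈′ = unique-++ xs u c∈ c∈′

same-block : ∀ {A B : Set} (f : A → List B) xs → Unique (concatMap f xs) → ∀ i j {c} →
             c ∈ f (lookup xs i) → c ∈ f (lookup xs j) → i ≡ j
same-block f (x ∷ xs) u zero    zero    _   _   = refl
same-block f (x ∷ xs) u zero    (suc j) c∈ c∈′ =
  ⊥-elim (unique-++ (f x) u c∈ (∈-concatMap⁺ f (Any.map (λ { refl → c∈′ }) (∈-lookup {xs = xs} j))))
same-block f (x ∷ xs) u (suc i) zero    c∈ c∈′ =
  ⊥-elim (unique-++ (f x) u c∈′ (∈-concatMap⁺ f (Any.map (λ { refl → c∈ }) (∈-lookup {xs = xs} i))))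
same-block f (x ∷ xs) u (suc i) (suc j) c∈ c∈′ = cong suc (same-block f xs (unique-++ʳ (f x) u) i j c∈ c∈′)

module _ (k : ℕ) .{{_ : NonZero k}} (gs : List Isometry) (length-gs : length gs ≡ k ℕ.^ 2)
         (ok : Construction.check k gs ≡ true) where
  open Mask (3 ℕ.* k)
  open Construction k gs

  private
    cs = concatMap footprint gs

    parts : T (all inside gs) × T (distinct 0 cs) × T (complete (fill 0 cs))
    parts = T-∧∧ (all inside gs) (distinct 0 cs) (Equivalence.from T-≡ ok)

  piece : Fin (k ℕ.^ 2) → Region
  piece i = image (lookup gs (cast (sym length-gs) i)) J

  piece-of : ∀ {g} → g ∈ gs → ∃[ i ] piece i ≡ image g J
  piece-of {g} g∈ = cast length-gs (Any.index g∈) , cong (λ h → image h J)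
    (trans (cong (lookup gs) (trans (Fin.cast-trans length-gs (sym length-gs) (Any.index g∈)) (Fin.cast-is-id refl (Any.index g∈))))
      (sym (lookup-index g∈)))

  private
    natural-cell : ∀ {g d} → g ∈ gs → d ∈ J-cells →
                   emb (abs (act g d)) ≡ act g d × abs (act g d) ∈ region k
    natural-cell {g} {d} g∈ d∈ =
      split (emb (abs (act g d)) ≟ act g d)
        (Equivalence.to T-∧ (All.lookup (all⁺ (fitting g) J-cells (All.lookup (all⁺ inside gs (proj₁ parts)) g∈)) d∈))
      where
      split : (eq? : Dec (emb (abs (act g d)) ≡ act g d)) → T (isYes eq?) × T (inkJ k (abs (act g d))) →
              emb (abs (act g d)) ≡ act g d × abs (act g d) ∈ region k
      split eq? (eq , c∈) = toWitness {a? = eq?} eq , ∈-region⁺ k c∈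

    footprint-region : ∀ {c} → c ∈ cs → c ∈ region k
    footprint-region c∈ with g , g∈ , c∈g ← find (∈-concatMap⁻ footprint {xs = gs} c∈)
      with d , d∈ , refl ← ∈-map⁻ (abs ∘ act g) {xs = J-cells} c∈g = proj₂ (natural-cell g∈ d∈)

    strip : InStrip cs
    strip = All.tabulate (λ c∈ → proj₁ (proj₂ (∈-region⁻ k (footprint-region c∈))))

    free-unique : Free 0 cs × Unique cs
    free-unique = distinct-sound strip (Equivalence.to T-≡ (proj₁ (proj₂ parts)))

    -- A cell outside all footprints would keep its digit from the empty set, against `complete`.
    covering : ∀ {c} → c ∈ region k → c ∈ cs
    covering {c} c∈ with c ∈ℕ? cs
    ... | yes c∈cs = c∈cs
    ... | no  c∉cs = contradiction (trans (sym (Equivalence.to T-≡ (All.lookup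
            (all⁺ (has (fill 0 cs)) (region k) (proj₂ (proj₂ parts))) c∈)))
          (trans (has-fill-∉ (proj₂ free-unique) (proj₁ free-unique) strip
            (proj₁ (proj₂ (∈-region⁻ k c∈))) c∉cs) (has-0 c))) λ ()

    footprint⁺ : ∀ g {c} → image g J c → abs c ∈ footprint g
    footprint⁺ g (d , d∈ , refl) = ∈-map⁺ (abs ∘ act g) d∈

    at : ∀ i → lookup gs i ∈ gs
    at i = ∈-lookup i

    cast-injective : ∀ {i j} → cast (sym length-gs) i ≡ cast (sym length-gs) j → i ≡ j
    cast-injective {i} {j} eq = Fin.toℕ-injective (trans (sym (Fin.toℕ-cast _ i))
      (trans (cong toℕ eq) (Fin.toℕ-cast _ j)))

    motion : Fin (k ℕ.^ 2) → Isometry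
    motion i = lookup gs (cast (sym length-gs) i)

    owner : ∀ {c} → c ∈ cs → ∃[ i ] piece i (emb c)
    owner {c} c∈ =
      let g , g∈ , c∈g = find (∈-concatMap⁻ footprint {xs = gs} c∈)
          d , d∈ , eq  = ∈-map⁻ (abs ∘ act g) {xs = J-cells} c∈g
          i , eq′      = piece-of g∈
      in i , subst (λ R → R (emb c)) (sym eq′)
               (d , d∈ , trans (sym (proj₁ (natural-cell {g} {d} g∈ d∈))) (cong emb (sym eq)))

    piece-inside : ∀ i {c} → piece i c → scale k J c
    piece-inside i (d , d∈ , eq) = proj₂ (scale-region k)
      (abs (act (motion i) d) , proj₂ cell , trans (proj₁ cell) eq)
      where cell = natural-cell {motion i} {d} (at (cast (sym length-gs) i)) d∈

    piece-disjoint : ∀ {i j} → i ≢ j → ∀ {c} → piece i c × piece j c → ⊥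
    piece-disjoint {i} {j} i≢j {c} (pi , pj) = i≢j (cast-injective
      (same-block footprint gs (proj₂ free-unique) (cast (sym length-gs) i) (cast (sym length-gs) j) {abs c}
        (footprint⁺ (motion i) {c} pi) (footprint⁺ (motion j) {c} pj)))

    piece-covers : ∀ {c} → scale k J c → ∃[ i ] piece i c
    piece-covers {c} c∈ =
      let c′ , c′∈ , eq = proj₁ (scale-region k) c∈
          i , pi        = owner (covering c′∈)
      in i , subst (piece i) eq pi

  construction : IsSolution J k piece
  construction = (λ i → motion i , ≐-refl) , (piece-covers , λ (i , pi) → piece-inside i pi) , piece-disjoint

module _ (k : ℕ) .{{_ : NonZero k}} (ms : List Motion) (length-ms : length (pieces ms) ≡ k ℕ.^ 2)
         (ok : Construction.check k (pieces ms) ≡ true) where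

  contains : ∀ {K g} → (K , g) ∈ ms → Contains (piece k (pieces ms) length-ms ok) (pair K)
  contains {K} {g} m∈ = g , λ
    { zero       → found (here refl) (image-cong g (≐-sym (pair-zero K)))
    ; (suc zero) → found (there (here refl)) (≐-trans (image-∙ g (turned K) J) (image-cong g (turned-partner K))) }
    where
    found : ∀ {h R} → h ∈ (g ∷ g ∙ turned K ∷ []) → image h J ≐ R →
            ∃[ i ] (piece k (pieces ms) length-ms ok i ≐ R)
    found {R = R} h∈ h≐ with i , eq ← piece-of k (pieces ms) length-ms ok
      (∈-concatMap⁺ (λ (K , g) → g ∷ g ∙ turned K ∷ []) {xs = ms} (Any.map (λ { refl → h∈ }) m∈)) =
      i , subst (_≐ R) (sym eq) h≐

  solution-containing : ∀ {g h} → (rec , g) ∈ ms → (cross , h) ∈ ms →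
    ∃[ p ] (IsSolution J k p × Contains p J-rec × Contains p J-X)
  solution-containing g∈ h∈ = piece k (pieces ms) length-ms ok ,
    construction k (pieces ms) length-ms ok , contains g∈ , contains h∈

mixed-solutions : All (λ k → ∃[ p ] (IsSolution J k p × Contains p J-rec × Contains p J-X)) (18 ∷ 24 ∷ [])
mixed-solutions =
    -- The list begins with the seven rectangles of the lowest band of the 15 × 16 rectangle; its
    -- eighth entry is `crossing`.
    solution-containing 18 (motions 18 6 9) refl refl (here refl) (there (there (there (there (there (there (there (here refl))))))))
  ∷ solution-containing 24 (motions 24 8 12) refl refl (here refl) (there (there (there (there (there (there (there (here refl))))))))
  ∷ []

theorem4 : ( (∀ (k : ℕ) → ¬ (2 ∣ k) → k ≢ 1 → ¬ IsRepTile-rep[ k ^2] J)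
    × All (λ k → ¬ IsRepTile-rep[ k ^2] J)
    (2 ∷ 4 ∷ 8 ∷ 10 ∷ 14 ∷ 16 ∷ 20 ∷ 22 ∷ []) )
    × (∀ (p : Fin (6 ^ 2) → Region) →
    IsSolution J 6 p ⇔ ObtainedFrom 6 rectanglesOf6J p)
    × (∀ (p : Fin (12 ^ 2) → Region) →
    IsSolution J 12 p ⇔
    (∃[ rect ] ((∀ (i : Fin 72) → Is3×4Rectangle (rect i))
    × ObtainedFrom 12 rect p)))
    × All (λ k → ∃[ p ] (IsSolution J k p × Contains p J-rec × Contains p J-X))
    (18 ∷ 24 ∷ [])
theorem4 = (odd⇒¬rep , small⇒¬rep) , solution-6J , solution-12J , mixed-solutions
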